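{- Let $r\ge 2$ and $\ell\in\{2,3,5\}$. If $H$ is any $r$-graph with maximum degree $\Delta$, then as $\Delta\to\infty$, $$\mathrm{ex}\left(H,\{TC^r_{r+1},TC^r_{r+2},\ldots,TC^r_{\ell r}\}\right)\ge \Delta^{ -\frac{\ell-1}{\ell(r-1)}-o(1)}\cdot e(H).$$
   Context: An $r$-graph is an $r$-uniform hypergraph. For integers $r<k$, the tight $k$-cycle $TC^r_k$ is the $r$-graph on vertices $u_0,\ldots,u_{k-1}$ with edges $\{u_i,u_{i+1},\ldots,u_{i+r-1}\}$ for $0\le i<k$, indices modulo $k$. For a family $\mathcal{F}$ of $r$-graphs, $\mathrm{ex}(H,\mathcal{F})$ is the maximum number of edges in a subgraph of $H$ containing no member of $\mathcal{F}$ as a subgraph. -}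

module Defs where

open import Data.Nat using (ℕ; zero; suc; _+_; _*_; _∸_; _^_; _≤_; _<_; _⊔_)
open import Data.Nat.DivMod using (_%_; m%n<n)
open import Data.Fin using (Fin; toℕ; fromℕ<)
open import Data.Fin.Subset using (Subset; ⁅_⁆; _∪_; ∣_∣) renaming (⊥ to ∅)
open import Data.Fin.Subset.Properties using (_∈?_)
open import Data.List using (List; length; filter; map; foldr; upTo; allFin)
open import Data.List.Membership.Propositional using (_∈_)
open import Data.List.Relation.Unary.All using (All)
open import Data.List.Relation.Unary.Unique.Propositional using (Unique)
open import Data.Product using (Σ; _×_)
open import Function.Definitions using (Injective)
open import Relation.Binary.PropositionalEquality using (_≡_)
open import Relation.Nullary using (¬_)

EdgeList : ℕ → Set
EdgeList n = List (Subset n)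

IsRGraph : (r : ℕ) {n : ℕ} → EdgeList n → Set
IsRGraph r E = All (λ e → ∣ e ∣ ≡ r) E × Unique E

e : {n : ℕ} → EdgeList n → ℕ
e E = length E

deg : {n : ℕ} → EdgeList n → Fin n → ℕ
deg E v = length (filter (λ s → v ∈? s) E)

maxDeg : {n : ℕ} → EdgeList n → ℕ
maxDeg {n} E = foldr _⊔_ 0 (map (deg E) (allFin n))

cycIdx : (m : ℕ) → Fin (suc m) → ℕ → Fin (suc m)
cycIdx m i j = fromℕ< (m%n<n (toℕ i + j) (suc m))

window : (r : ℕ) {m n : ℕ} → (Fin (suc m) → Fin n) → Fin (suc m) → Subset n
window r {m} f i = foldr _∪_ ∅ (map (λ j → ⁅ f (cycIdx m i j) ⁆) (upTo r))

-- G contains a copy of the tight cycle TC^r_k, with k = suc m: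
-- distinct vertices f(0),...,f(k-1) with every cyclic r-window an edge of G.
ContainsTC : (r m : ℕ) {n : ℕ} → EdgeList n → Set
ContainsTC r m {n} G =
  Σ (Fin (suc m) → Fin n) λ f → Injective _≡_ _≡_ f × ((i : Fin (suc m)) → window r f i ∈ G)

TCFree : (r ℓ : ℕ) {n : ℕ} → EdgeList n → Set
TCFree r ℓ G = (m : ℕ) → r ≤ m → suc m ≤ ℓ * r → ¬ ContainsTC r m G

{-# OPTIONS --safe #-}
module Submission where

-- Colour the vertices of H with r colours so that a positive proportion of the edges is rainbow. A tight cycle of
-- rainbow edges has length jr and is coloured periodically, so its vertices of two colours a, b trace a closed walk
-- of length 2j, and it suffices to map these vertices to the points and lines of a generalised polygon in such a
-- way that edges go to incident pairs and the walk does not backtrack: it is then too short to close up.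
--
-- Backtracking is only caused by pairs of edges that differ in a single vertex of colour a or b. Let T ^ (r - 1) be
-- about Δ. An edge of codegree above T in all colours but c, hereditarily, would give (T + 1) ^ (r - 1) > Δ edges
-- through its vertex of colour c; hence, keeping a constant proportion of the edges, there are two colours a, b in
-- which all codegrees are at most T. Mapping the vertices to (ℤ/P) ^ ℓ with P ^ ℓ ≥ 4 T, half of the edges avoid all
-- backtracking conflicts, and by pigeonhole a proportion P ^ -(ℓ - 1) of those lies in one translate of the polygon.
-- The o(1) in the exponent only absorbs the constants and the gap between P and (4 T) ^ (1 / ℓ).

-- The incidence graph of the affine part of a generalised (ℓ + 1)-gon has P ^ ℓ points, P ^ ℓ
-- lines, degree P and girth above 2ℓ. Such polygons are available for ℓ + 1 = 3, 4, 6, whence ℓ =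
-- 2, 3, 5. All lengths jr with j ≤ ℓ must be excluded at once, so a large girth is needed and not
-- merely the absence of cycles of length 2ℓ.
--
-- The exponent arises from two demands on P. Separating conflicting vertices asks for P ^ ℓ of
-- order T, that is Δ ^ (1 / (r - 1)); incidence then costs P ^ (ℓ - 1), which is Δ ^ ((ℓ - 1) / (ℓ
-- (r - 1))). All other losses depend only on r.
--
-- Any translate is as good as the polygon itself: along a walk only differences of incidence
-- equations matter, and a common defect cancels from them. The equations are kept as congruences
-- between integers, and all real exponents are cleared by raising to powers.

module ClosedWalks where

  open import Data.Nat as ℕ using (ℕ; zero; suc)
  import Data.Nat.Properties as ℕₚ
  import Data.Nat.Divisibility as ℕᵈ
  open import Data.Nat.Primality using (Prime; euclidsLemma)
  open import Data.Integer using (ℤ; +_; -_; _+_; _*_; _-_; ∣_∣)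
  import Data.Integer.Properties as ℤₚ
  open import Data.Integer.Divisibility.Signed using (_∣_; divides; ∣⇒∣ᵤ; ∣ᵤ⇒∣; ∣m∣n⇒∣m+n; ∣m∣n⇒∣m-n; ∣m⇒∣-m; ∣n⇒∣m*n)
  open import Data.Integer.Tactic.RingSolver using (solve-∀)
  open import Data.Sum using (_⊎_; inj₁; inj₂)
  open import Data.Bool using (true; false; if_then_else_; T)
  open import Data.Empty using (⊥; ⊥-elim)
  open import Relation.Nullary using (¬_; yes; no)
  open import Relation.Binary.PropositionalEquality

  -- Moments, area and incidence equations

  windowSum : (ℕ → ℤ) → ℕ → ℕ → ℤ
  windowSum F zero    s = + 0
  windowSum F (suc j) s = F s + windowSum F j (suc s)

  pow : ℤ → ℕ → ℤ
  pow a zero    = + 1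
  pow a (suc i) = a * pow a i

  -- The symplectic form on binary cubics, evaluated at (1, a, a², a³): it is (a - a')³ at l = (1, a', a'², a'³).
  ω : ℤ → (ℕ → ℤ) → ℤ
  ω a l = a * a * a * l 0 - + 3 * (a * a * l 1) + + 3 * (a * l 2) - l 3

  coefficient : ℕ → ℤ → (ℕ → ℤ) → ℤ
  coefficient i a l = if i ℕ.≡ᵇ 4 then ω a l else pow a i

  incidence : ℕ → ℤ → (ℕ → ℤ) → ℤ
  incidence i a l = l 0 * coefficient i a l

  -- A point p and a line l of coordinates 0, …, ℓ - 1 are incident when the defects 1, …, ℓ - 1 vanish. For ℓ = 2, 3, 5
  -- these are affine parts of a projective plane, a generalised quadrangle and the split Cayley hexagon.
  defect : ℕ → (ℕ → ℤ) → (ℕ → ℤ) → ℤ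
  defect i p l = p i + l i - incidence i (p 0) l

  momentTerm : (A D : ℕ → ℤ) → ℕ → ℕ → ℤ
  momentTerm A D i t = D t * pow (A t) i

  shift : (ℕ → ℤ) → ℤ → ℤ → ℕ → ℤ
  shift v a d i = v i + d * pow a i

  cube : ℤ → ℤ
  cube x = x * x * x

  -- The coordinate 4 accumulates ∑ D s * D t * (A t - A s)³ over s < t, besides multiples of the moments.
  area : (A D : ℕ → ℤ) → (ℕ → ℤ) → ℕ → ℕ → ℤ
  area A D v zero    s = + 0
  area A D v (suc j) s = D s * ω (A s) v + area A D (shift v (A s) (D s)) j (suc s)

  module Modulo (P : ℕ) (prime : Prime P) where

    Null : ℤ → Set
    Null x = + P ∣ x

    null-0 : Null (+ 0)
    null-0 = divides (+ 0) refl

    null-* : ∀ x y → Null (x * y) → Null x ⊎ Null y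
    null-* x y d with euclidsLemma ∣ x ∣ ∣ y ∣ prime (subst (P ℕᵈ.∣_) (ℤₚ.abs-* x y) (∣⇒∣ᵤ d))
    ... | inj₁ p = inj₁ (∣ᵤ⇒∣ p)
    ... | inj₂ p = inj₂ (∣ᵤ⇒∣ p)

    ¬null-* : ∀ {x y} → ¬ Null x → ¬ Null y → ¬ Null (x * y)
    ¬null-* {x} {y} nx ny d with null-* x y d
    ... | inj₁ p = nx p
    ... | inj₂ p = ny p

    null-by : ∀ {x y} → x ≡ y → Null y → Null x
    null-by eq = subst Null (sym eq)

    seq : (x₀ x₁ x₂ x₃ x₄ : ℤ) → ℕ → ℤ
    seq x₀ x₁ x₂ x₃ x₄ 0 = x₀
    seq x₀ x₁ x₂ x₃ x₄ 1 = x₁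
    seq x₀ x₁ x₂ x₃ x₄ 2 = x₂
    seq x₀ x₁ x₂ x₃ x₄ 3 = x₃
    seq x₀ x₁ x₂ x₃ x₄ _ = x₄

    moment : (A D : ℕ → ℤ) → ℕ → ℕ → ℤ
    moment A D i j = windowSum (momentTerm A D i) j 0

    twoPoints : ∀ A D → ¬ Null (D 0) → ¬ Null (A 0 - A 1) →
      Null (moment A D 0 2) → Null (moment A D 1 2) → ⊥
    twoPoints A D nd na m₀ m₁ =
      ¬null-* nd na (null-by (expand (D 0) (D 1) (A 0) (A 1)) (∣m∣n⇒∣m-n m₁ (∣n⇒∣m*n (A 1) m₀)))
      where
      expand : ∀ d₀ d₁ a₀ a₁ → d₀ * (a₀ - a₁) ≡
        (d₀ * (a₀ * + 1) + (d₁ * (a₁ * + 1) + + 0)) - a₁ * (d₀ * + 1 + (d₁ * + 1 + + 0))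
      expand = solve-∀

    -- The moments combine to the sum of `D t * f (A t)` for the polynomial f (x) = (x - A 1)(x - A
    -- 2), and only the term t = 0 survives. `A 1` and `A 2` may coincide, which admits padded
    -- walks.
    threePoints : ∀ A D → ¬ Null (D 0) → ¬ Null (A 0 - A 1) → ¬ Null (A 0 - A 2) →
      Null (moment A D 0 3) → Null (moment A D 1 3) → Null (moment A D 2 3) → ⊥
    threePoints A D nd n₁ n₂ m₀ m₁ m₂ =
      ¬null-* nd (¬null-* n₁ n₂) (null-by (expand (D 0) (D 1) (D 2) (A 0) (A 1) (A 2))
        (∣m∣n⇒∣m+n (∣m∣n⇒∣m-n m₂ (∣n⇒∣m*n (A 1 + A 2) m₁)) (∣n⇒∣m*n (A 1 * A 2) m₀)))
      where
      expand : ∀ d₀ d₁ d₂ a₀ a₁ a₂ → d₀ * ((a₀ - a₁) * (a₀ - a₂)) ≡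
        (d₀ * (a₀ * (a₀ * + 1)) + (d₁ * (a₁ * (a₁ * + 1)) + (d₂ * (a₂ * (a₂ * + 1)) + + 0)))
          - (a₁ + a₂) * (d₀ * (a₀ * + 1) + (d₁ * (a₁ * + 1) + (d₂ * (a₂ * + 1) + + 0)))
          + a₁ * a₂ * (d₀ * + 1 + (d₁ * + 1 + (d₂ * + 1 + + 0)))
      expand = solve-∀

    cofactor₃ : (d₀ d₁ d₂ d₃ a₀ a₁ a₂ : ℤ) → ℤ
    cofactor₃ d₀ d₁ d₂ d₃ a₀ a₁ a₂ =
      - (d₀ * a₂) - d₁ * a₂ + d₂ * a₂ + d₃ * a₂ + + 2 * (d₁ * a₁) + + 2 * (d₀ * a₀)

    cofactor₂ : (d₀ d₁ d₂ d₃ a₀ a₁ a₂ a₃ : ℤ) → ℤ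
    cofactor₂ d₀ d₁ d₂ d₃ a₀ a₁ a₂ a₃ =
      + 2 * (d₃ * (a₃ * a₃)) - + 3 * (d₃ * (a₂ * a₃)) - d₂ * (a₂ * a₂) + d₁ * (a₁ * a₂)
        - + 2 * (d₁ * (a₁ * a₁)) + d₀ * (a₀ * a₂) - + 2 * (d₀ * (a₀ * a₀))

    cofactor₁ : (d₃ a₂ a₃ : ℤ) → ℤ
    cofactor₁ d₃ a₂ a₃ = + 2 * (d₃ * (a₂ * (a₃ * a₃))) - + 2 * (d₃ * (a₃ * (a₃ * a₃)))

    -- Modulo the moments, a₂ times the area is -2 times a product of d's and of differences of consecutive a's, none
    -- of which vanishes. Here a₄ has been translated to 0; the cofactors come from solving a linear system.
    certificate : ∀ d₀ d₁ d₂ d₃ a₀ a₁ a₂ a₃ →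
      + 2 * (d₀ * (d₁ * ((a₀ - a₁) * ((a₀ - a₁) * (a₀ * (a₁ - a₂)))))) ≡
        ((- (d₀ * a₂) - d₁ * a₂ + d₂ * a₂ + d₃ * a₂ + + 2 * (d₁ * a₁) + + 2 * (d₀ * a₀))
          * (d₀ * (a₀ * a₀ * a₀) + d₁ * (a₁ * a₁ * a₁) + d₂ * (a₂ * a₂ * a₂) + d₃ * (a₃ * a₃ * a₃))
        + (+ 2 * (d₃ * (a₃ * a₃)) - + 3 * (d₃ * (a₂ * a₃)) - d₂ * (a₂ * a₂) + d₁ * (a₁ * a₂)
            - + 2 * (d₁ * (a₁ * a₁)) + d₀ * (a₀ * a₂) - + 2 * (d₀ * (a₀ * a₀)))
          * (d₀ * (a₀ * a₀) + d₁ * (a₁ * a₁) + d₂ * (a₂ * a₂) + d₃ * (a₃ * a₃))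
        + (+ 2 * (d₃ * (a₂ * (a₃ * a₃))) - + 2 * (d₃ * (a₃ * (a₃ * a₃))))
          * (d₀ * a₀ + d₁ * a₁ + d₂ * a₂ + d₃ * a₃))
        - a₂ * (d₀ * d₁ * ((a₀ - a₁) * (a₀ - a₁) * (a₀ - a₁)) + d₀ * d₂ * ((a₀ - a₂) * (a₀ - a₂) * (a₀ - a₂))
          + d₀ * d₃ * ((a₀ - a₃) * (a₀ - a₃) * (a₀ - a₃)) + d₁ * d₂ * ((a₁ - a₂) * (a₁ - a₂) * (a₁ - a₂)) + d₁
          * d₃ * ((a₁ - a₃) * (a₁ - a₃) * (a₁ - a₃)) + d₂ * d₃ * ((a₂ - a₃) * (a₂ - a₃) * (a₂ - a₃)))
    certificate = solve-∀

    ω-zero : ∀ a → ω a (λ _ → + 0) ≡ + 0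
    ω-zero = expand
      where
      expand : ∀ a → a * a * a * + 0 - + 3 * (a * a * + 0) + + 3 * (a * + 0) - + 0 ≡ + 0
      expand = solve-∀

    ω-shift : ∀ a v b d → ω a (shift v b d) ≡ ω a v + d * cube (a - b)
    ω-shift a v b d = expand a b d (v 0) (v 1) (v 2) (v 3)
      where
      expand : ∀ a b d v₀ v₁ v₂ v₃ →
        a * a * a * (v₀ + d * + 1) - + 3 * (a * a * (v₁ + d * (b * + 1)))
          + + 3 * (a * (v₂ + d * (b * (b * + 1)))) - (v₃ + d * (b * (b * (b * + 1)))) ≡
        a * a * a * v₀ - + 3 * (a * a * v₁) + + 3 * (a * v₂) - v₃ + d * ((a - b) * (a - b) * (a - b))
      expand = solve-∀

    -- The moments and the area are written out as they compute, since the solver does not unfold definitions.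
    translate₁ : ∀ d₀ d₁ d₂ d₃ d₄ a₀ a₁ a₂ a₃ a₄ → d₀ * (a₀ - a₄) + d₁ * (a₁ - a₄) + d₂ * (a₂ - a₄) + d₃ * (a₃ - a₄) ≡
      (d₀ * (a₀ * + 1) + (d₁ * (a₁ * + 1) + (d₂ * (a₂ * + 1) + (d₃ * (a₃ * + 1) + (d₄ * (a₄ * + 1) + + 0))))) -
        a₄ * (d₀ * (+ 1) + (d₁ * (+ 1) + (d₂ * (+ 1) + (d₃ * (+ 1) + (d₄ * (+ 1) + + 0)))))
    translate₁ = solve-∀

    translate₂ : ∀ d₀ d₁ d₂ d₃ d₄ a₀ a₁ a₂ a₃ a₄ → d₀ * ((a₀ - a₄) * (a₀ - a₄)) + d₁ * ((a₁ - a₄) * (a₁ - a₄)) +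
      d₂ * ((a₂ - a₄) * (a₂ - a₄)) + d₃ * ((a₃ - a₄) * (a₃ - a₄)) ≡
      (d₀ * (a₀ * (a₀ * + 1)) + (d₁ * (a₁ * (a₁ * + 1)) + (d₂ * (a₂ * (a₂ * + 1)) + (d₃ * (a₃ * (a₃ * + 1)) +
        (d₄ * (a₄ * (a₄ * + 1)) + + 0))))) - + 2 * a₄ * (d₀ * (a₀ * + 1) + (d₁ * (a₁ * + 1) + (d₂ * (a₂ * + 1) +
        (d₃ * (a₃ * + 1) + (d₄ * (a₄ * + 1) + + 0))))) + a₄ * a₄ * (d₀ * (+ 1) + (d₁ * (+ 1) + (d₂ * (+ 1) + (d₃
        * (+ 1) + (d₄ * (+ 1) + + 0)))))
    translate₂ = solve-∀

    translate₃ : ∀ d₀ d₁ d₂ d₃ d₄ a₀ a₁ a₂ a₃ a₄ → d₀ * ((a₀ - a₄) * (a₀ - a₄) * (a₀ - a₄)) + d₁ * ((a₁ - a₄) *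
      (a₁ - a₄) * (a₁ - a₄)) + d₂ * ((a₂ - a₄) * (a₂ - a₄) * (a₂ - a₄)) + d₃ * ((a₃ - a₄) * (a₃ - a₄) * (a₃ - a₄))
      ≡
      (d₀ * (a₀ * (a₀ * (a₀ * + 1))) + (d₁ * (a₁ * (a₁ * (a₁ * + 1))) + (d₂ * (a₂ * (a₂ * (a₂ * + 1))) + (d₃ *
        (a₃ * (a₃ * (a₃ * + 1))) + (d₄ * (a₄ * (a₄ * (a₄ * + 1))) + + 0))))) - + 3 * a₄ * (d₀ * (a₀ * (a₀ * +
        1)) + (d₁ * (a₁ * (a₁ * + 1)) + (d₂ * (a₂ * (a₂ * + 1)) + (d₃ * (a₃ * (a₃ * + 1)) + (d₄ * (a₄ * (a₄ * +
        1)) + + 0))))) + + 3 * (a₄ * a₄) * (d₀ * (a₀ * + 1) + (d₁ * (a₁ * + 1) + (d₂ * (a₂ * + 1) + (d₃ * (a₃ *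
        + 1) + (d₄ * (a₄ * + 1) + + 0))))) - a₄ * a₄ * a₄ * (d₀ * (+ 1) + (d₁ * (+ 1) + (d₂ * (+ 1) + (d₃ * (+
        1) + (d₄ * (+ 1) + + 0)))))
    translate₃ = solve-∀

    translateArea : ∀ d₀ d₁ d₂ d₃ d₄ a₀ a₁ a₂ a₃ a₄ → d₀ * d₁ * ((((a₀ - a₄) - (a₁ - a₄)) * ((a₀ - a₄) - (a₁ -
      a₄)) * ((a₀ - a₄) - (a₁ - a₄)))) + d₀ * d₂ * ((((a₀ - a₄) - (a₂ - a₄)) * ((a₀ - a₄) - (a₂ - a₄)) * ((a₀ -
      a₄) - (a₂ - a₄)))) + d₀ * d₃ * ((((a₀ - a₄) - (a₃ - a₄)) * ((a₀ - a₄) - (a₃ - a₄)) * ((a₀ - a₄) - (a₃ -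
      a₄)))) + d₁ * d₂ * ((((a₁ - a₄) - (a₂ - a₄)) * ((a₁ - a₄) - (a₂ - a₄)) * ((a₁ - a₄) - (a₂ - a₄)))) + d₁ * d₃
      * ((((a₁ - a₄) - (a₃ - a₄)) * ((a₁ - a₄) - (a₃ - a₄)) * ((a₁ - a₄) - (a₃ - a₄)))) + d₂ * d₃ * ((((a₂ - a₄) -
      (a₃ - a₄)) * ((a₂ - a₄) - (a₃ - a₄)) * ((a₂ - a₄) - (a₃ - a₄)))) ≡
      - (d₀ * (+ 0) + (d₁ * (+ 0 + d₀ * ((a₁ - a₀) * (a₁ - a₀) * (a₁ - a₀))) + (d₂ * (+ 0 + d₀ * ((a₂ - a₀) *
        (a₂ - a₀) * (a₂ - a₀)) + d₁ * ((a₂ - a₁) * (a₂ - a₁) * (a₂ - a₁))) + (d₃ * (+ 0 + d₀ * ((a₃ - a₀) * (a₃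
        - a₀) * (a₃ - a₀)) + d₁ * ((a₃ - a₁) * (a₃ - a₁) * (a₃ - a₁)) + d₂ * ((a₃ - a₂) * (a₃ - a₂) * (a₃ -
        a₂))) + (d₄ * (+ 0 + d₀ * ((a₄ - a₀) * (a₄ - a₀) * (a₄ - a₀)) + d₁ * ((a₄ - a₁) * (a₄ - a₁) * (a₄ - a₁))
        + d₂ * ((a₄ - a₂) * (a₄ - a₂) * (a₄ - a₂)) + d₃ * ((a₄ - a₃) * (a₄ - a₃) * (a₄ - a₃))) + + 0))))) - d₄ *
        (d₀ * ((a₀ - a₄) * (a₀ - a₄) * (a₀ - a₄)) + d₁ * ((a₁ - a₄) * (a₁ - a₄) * (a₁ - a₄)) + d₂ * ((a₂ - a₄) *
        (a₂ - a₄) * (a₂ - a₄)) + d₃ * ((a₃ - a₄) * (a₃ - a₄) * (a₃ - a₄)))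
    translateArea = solve-∀

    -- Moments alone cannot suffice: all of them vanish for A = (a, b, a, b) and D = (1, 1, -1, -1),
    -- a walk of four steps that does not backtrack. Its area is 2 (b - a)³, which shows why the
    -- fifth coordinate is not a power and why 2 must be invertible.
    fivePoints : ∀ A D → ¬ Null (+ 2) → ¬ Null (D 0) → ¬ Null (D 1) →
      ¬ Null (A 0 - A 1) → ¬ Null (A 1 - A 2) → ¬ Null (A 0 - A 4) →
      Null (moment A D 0 5) → Null (moment A D 1 5) → Null (moment A D 2 5) → Null (moment A D 3 5) →
      Null (area A D (λ _ → + 0) 5 0) → ⊥
    fivePoints A D n2 nd₀ nd₁ n₀₁ n₁₂ n₀₄ m₀ m₁ m₂ m₃ q =
      ¬null-* n2 (¬null-* nd₀ (¬null-* nd₁ (¬null-* n₀₁′ (¬null-* n₀₁′ (¬null-* n₀₄ n₁₂′)))))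
        (null-by (certificate d₀ d₁ d₂ d₃ b₀ b₁ b₂ b₃)
          (∣m∣n⇒∣m-n (∣m∣n⇒∣m+n (∣m∣n⇒∣m+n (∣n⇒∣m*n (cofactor₃ d₀ d₁ d₂ d₃ b₀ b₁ b₂) m₃′)
              (∣n⇒∣m*n (cofactor₂ d₀ d₁ d₂ d₃ b₀ b₁ b₂ b₃) m₂′)) (∣n⇒∣m*n (cofactor₁ d₃ b₂ b₃) m₁′))
            (∣n⇒∣m*n b₂ q′)))
      where
      d₀ = D 0 ; d₁ = D 1 ; d₂ = D 2 ; d₃ = D 3 ; d₄ = D 4
      a₀ = A 0 ; a₁ = A 1 ; a₂ = A 2 ; a₃ = A 3 ; a₄ = A 4
      b₀ = a₀ - a₄ ; b₁ = a₁ - a₄ ; b₂ = a₂ - a₄ ; b₃ = a₃ - a₄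
      difference : ∀ x y z → (x - z) - (y - z) ≡ x - y
      difference = solve-∀
      n₀₁′ : ¬ Null ((a₀ - a₄) - (a₁ - a₄))
      n₀₁′ = subst (λ z → ¬ Null z) (sym (difference a₀ a₁ a₄)) n₀₁
      n₁₂′ : ¬ Null ((a₁ - a₄) - (a₂ - a₄))
      n₁₂′ = subst (λ z → ¬ Null z) (sym (difference a₁ a₂ a₄)) n₁₂
      m₁′ = null-by (translate₁ d₀ d₁ d₂ d₃ d₄ a₀ a₁ a₂ a₃ a₄) (∣m∣n⇒∣m-n m₁ (∣n⇒∣m*n a₄ m₀))
      m₂′ = null-by (translate₂ d₀ d₁ d₂ d₃ d₄ a₀ a₁ a₂ a₃ a₄)
        (∣m∣n⇒∣m+n (∣m∣n⇒∣m-n m₂ (∣n⇒∣m*n (+ 2 * a₄) m₁)) (∣n⇒∣m*n (a₄ * a₄) m₀))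
      m₃′ = null-by (translate₃ d₀ d₁ d₂ d₃ d₄ a₀ a₁ a₂ a₃ a₄)
        (∣m∣n⇒∣m-n (∣m∣n⇒∣m+n (∣m∣n⇒∣m-n m₃ (∣n⇒∣m*n (+ 3 * a₄) m₂)) (∣n⇒∣m*n (+ 3 * (a₄ * a₄)) m₁))
          (∣n⇒∣m*n (a₄ * a₄ * a₄) m₀))
      v₀ = λ (_ : ℕ) → + 0
      v₁ = shift v₀ a₀ d₀ ; v₂ = shift v₁ a₁ d₁ ; v₃ = shift v₂ a₂ d₂ ; v₄ = shift v₃ a₃ d₃
      ω₁ : ∀ a → ω a v₁ ≡ + 0 + d₀ * cube (a - a₀)
      ω₁ a = trans (ω-shift a v₀ a₀ d₀) (cong (_+ d₀ * cube (a - a₀)) (ω-zero a))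
      ω₂ : ∀ a → ω a v₂ ≡ + 0 + d₀ * cube (a - a₀) + d₁ * cube (a - a₁)
      ω₂ a = trans (ω-shift a v₁ a₁ d₁) (cong (_+ d₁ * cube (a - a₁)) (ω₁ a))
      ω₃ : ∀ a → ω a v₃ ≡ + 0 + d₀ * cube (a - a₀) + d₁ * cube (a - a₁) + d₂ * cube (a - a₂)
      ω₃ a = trans (ω-shift a v₂ a₂ d₂) (cong (_+ d₂ * cube (a - a₂)) (ω₂ a))
      ω₄ : ω a₄ v₄ ≡ + 0 + d₀ * cube (a₄ - a₀) + d₁ * cube (a₄ - a₁) + d₂ * cube (a₄ - a₂) + d₃ * cube (a₄ - a₃)
      ω₄ = trans (ω-shift a₄ v₃ a₃ d₃) (cong (_+ d₃ * cube (a₄ - a₃)) (ω₃ a₄))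
      areaExpansion = cong₂ _+_ (cong (d₀ *_) (ω-zero a₀)) (cong₂ _+_ (cong (d₁ *_) (ω₁ a₁))
        (cong₂ _+_ (cong (d₂ *_) (ω₂ a₂)) (cong₂ _+_ (cong (d₃ *_) (ω₃ a₃)) (cong₂ _+_ (cong (d₄ *_) ω₄) refl))))
      -- The pairs involving the fifth point contribute `d₄` times the translated third moment, so
      -- that the certificate has to deal with four points only.
      q′ = null-by (translateArea d₀ d₁ d₂ d₃ d₄ a₀ a₁ a₂ a₃ a₄)
        (∣m∣n⇒∣m-n (∣m⇒∣-m (subst Null areaExpansion q)) (∣n⇒∣m*n d₄ m₃′))

    -- Walks alternating between points and lines modulo P

    null-sym : ∀ x y → Null (x - y) → Null (y - x)
    null-sym x y d = null-by (swap x y) (∣m⇒∣-m d)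
      where
      swap : ∀ x y → y - x ≡ - (x - y)
      swap = solve-∀

    null-pow : ∀ i {a b} → Null (a - b) → Null (pow a i - pow b i)
    null-pow zero d = null-0
    null-pow (suc i) {a} {b} d =
      null-by (expand a b (pow a i) (pow b i)) (∣m∣n⇒∣m+n (∣n⇒∣m*n a (null-pow i {a} {b} d)) (∣n⇒∣m*n (pow b i) d))
      where
      expand : ∀ a b x y → a * x - b * y ≡ a * (x - y) + y * (a - b)
      expand = solve-∀

    null-coefficient : ∀ i l {a b} → Null (a - b) → Null (coefficient i a l - coefficient i b l)
    null-coefficient i l {a} {b} d with i ℕ.≡ᵇ 4
    ... | false = null-pow i {a} {b} d
    ... | true = null-by (expand a b (l 0) (l 1) (l 2) (l 3))
      (∣n⇒∣m*n ((a * a + a * b + b * b) * l 0 - + 3 * ((a + b) * l 1) + + 3 * l 2) d)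
      where
      expand : ∀ a b l₀ l₁ l₂ l₃ →
        (a * a * a * l₀ - + 3 * (a * a * l₁) + + 3 * (a * l₂) - l₃)
          - (b * b * b * l₀ - + 3 * (b * b * l₁) + + 3 * (b * l₂) - l₃) ≡
        ((a * a + a * b + b * b) * l₀ - + 3 * ((a + b) * l₁) + + 3 * l₂) * (a - b)
      expand = solve-∀

    -- The line `Y t` meets the points `X t` and `X (suc t)`, where incidence is taken in the
    -- translate with defects `c`. The sequences are infinite so that closed walks are just periodic
    -- ones.
    module Walk (ℓ : ℕ) (X Y : ℕ → ℕ → ℤ) (c : ℕ → ℤ)
      (on  : ∀ t i → suc i ℕ.< ℓ → Null (defect (suc i) (X t) (Y t) - c i))
      (on′ : ∀ t i → suc i ℕ.< ℓ → Null (defect (suc i) (X (suc t)) (Y t) - c i))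
      (movesX : ∀ t → ¬ (∀ i → i ℕ.< ℓ → Null (X t i - X (suc t) i)))
      (movesY : ∀ t → ¬ (∀ i → i ℕ.< ℓ → Null (Y t i - Y (suc t) i)))
      where

      A D : ℕ → ℤ
      A t = X (suc t) 0
      D t = Y (suc t) 0 - Y t 0

      -- On a given line the coordinate 0 of a point determines its other coordinates, so distinct
      -- points of `Y t` already differ there.
      movesX₀ : ∀ t → ¬ Null (X t 0 - X (suc t) 0)
      movesX₀ t d = movesX t agree
        where
        expand : ∀ x x′ y b k k′ c → x - x′ ≡
          ((x + y - b * k) - c) - ((x′ + y - b * k′) - c) + b * (k - k′)
        expand = solve-∀
        agree : ∀ i → i ℕ.< ℓ → Null (X t i - X (suc t) i)
        agree zero _ = d
        agree (suc i) i<ℓ =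
          null-by (expand (X t (suc i)) (X (suc t) (suc i)) (Y t (suc i)) (Y t 0)
                     (coefficient (suc i) (X t 0) (Y t)) (coefficient (suc i) (X (suc t) 0) (Y t)) (c i))
            (∣m∣n⇒∣m+n (∣m∣n⇒∣m-n (on t i i<ℓ) (on′ t i i<ℓ))
              (∣n⇒∣m*n (Y t 0) (null-coefficient (suc i) (Y t) {X t 0} {X (suc t) 0} d)))

      -- Subtracting the equations of the two lines through `X (suc t)` cancels the coordinate of
      -- that point. The index 4 is treated apart because its coefficient depends on the line.
      step : ∀ t i → i ℕ.< ℓ → i ≢ 4 → Null (Y (suc t) i - Y t i - D t * pow (A t) i)
      step t zero _ _ = null-by (expand (Y (suc t) 0) (Y t 0)) null-0
        where
        expand : ∀ y′ y → y′ - y - (y′ - y) * + 1 ≡ + 0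
        expand = solve-∀
      step t (suc i) i<ℓ i≢4 with suc i ℕ.≡ᵇ 4 in eq | on (suc t) i i<ℓ | on′ t i i<ℓ
      ... | true  | _ | _ = ⊥-elim (i≢4 (ℕₚ.≡ᵇ⇒≡ (suc i) 4 (subst T (sym eq) _)))
      ... | false | E | E′ =
        null-by (expand (Y (suc t) (suc i)) (Y t (suc i)) (X (suc t) (suc i)) (pow (A t) (suc i)) (Y (suc t) 0) (Y t 0) (c i))
          (∣m∣n⇒∣m-n E E′)
        where
        expand : ∀ y′ y x k b′ b c → y′ - y - (b′ - b) * k ≡
          ((x + y′ - b′ * k) - c) - ((x + y - b * k) - c)
        expand = solve-∀

      -- By `step`, the two lines through the point differ in the coordinates 0 to 3 by `D t` times
      -- (1, a, a², a³), and `ω a` vanishes at that vector. So both lines have the same coefficient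
      -- after all, and the computation of `step` applies.
      step₄ : 4 ℕ.< ℓ → ∀ t → Null (Y (suc t) 4 - Y t 4 - D t * ω (A t) (Y t))
      step₄ 4<ℓ t =
        null-by (expand (Y (suc t) 4) (Y t 4) (X (suc t) 4) (ω (A t) (Y (suc t))) (ω (A t) (Y t)) (Y (suc t) 0) (Y t 0) (c 3))
          (∣m∣n⇒∣m+n (∣m∣n⇒∣m-n (on (suc t) 3 4<ℓ) (on′ t 3 4<ℓ)) (∣n⇒∣m*n (Y (suc t) 0) ωStep))
        where
        expand : ∀ y′ y x k′ k b′ b c → y′ - y - (b′ - b) * k ≡
          ((x + y′ - b′ * k′) - c) - ((x + y - b * k) - c) + b′ * (k′ - k)
        expand = solve-∀
        expandω : ∀ a d l₀ l₁ l₂ l₃ m₀ m₁ m₂ m₃ →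
          (a * a * a * m₀ - + 3 * (a * a * m₁) + + 3 * (a * m₂) - m₃)
            - (a * a * a * l₀ - + 3 * (a * a * l₁) + + 3 * (a * l₂) - l₃) ≡
          a * a * a * (m₀ - l₀ - d * + 1) - + 3 * (a * a) * (m₁ - l₁ - d * (a * + 1))
            + + 3 * a * (m₂ - l₂ - d * (a * (a * + 1))) - (m₃ - l₃ - d * (a * (a * (a * + 1))))
        expandω = solve-∀
        a = A t
        small : ∀ {i} → i ℕ.< 4 → i ℕ.< ℓ
        small i<4 = ℕₚ.<-trans i<4 4<ℓ
        ωStep : Null (ω (A t) (Y (suc t)) - ω (A t) (Y t))
        ωStep = null-by (expandω (A t) (D t) (Y t 0) (Y t 1) (Y t 2) (Y t 3) (Y (suc t) 0) (Y (suc t) 1) (Y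
          (suc t) 2) (Y (suc t) 3))
          (∣m∣n⇒∣m-n (∣m∣n⇒∣m+n (∣m∣n⇒∣m-n
            (∣n⇒∣m*n (a * a * a) (step t 0 (small (ℕ.s≤s ℕ.z≤n)) λ ()))
            (∣n⇒∣m*n (+ 3 * (a * a)) (step t 1 (small (ℕ.s≤s (ℕ.s≤s ℕ.z≤n))) λ ())))
            (∣n⇒∣m*n (+ 3 * a) (step t 2 (small (ℕ.s≤s (ℕ.s≤s (ℕ.s≤s ℕ.z≤n)))) λ ())))
            (step t 3 (small ℕₚ.≤-refl) λ ()))

      movesY₀ : ∀ t → ¬ Null (D t)
      movesY₀ t d = movesY t agree
        where
        agree : ∀ i → i ℕ.< ℓ → Null (Y t i - Y (suc t) i)
        expand : ∀ y y′ d k → y - y′ ≡ - (y′ - y - d * k) - k * d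
        expand = solve-∀
        agree i i<ℓ with i ℕ.≟ 4
        ... | yes refl = null-by (expand (Y t 4) (Y (suc t) 4) (D t) (ω (A t) (Y t)))
          (∣m∣n⇒∣m-n (∣m⇒∣-m (step₄ i<ℓ t)) (∣n⇒∣m*n (ω (A t) (Y t)) d))
        ... | no i≢4 = null-by (expand (Y t i) (Y (suc t) i) (D t) (pow (A t) i))
          (∣m∣n⇒∣m-n (∣m⇒∣-m (step t i i<ℓ i≢4)) (∣n⇒∣m*n (pow (A t) i) d))

      momentFrom : ℕ → ℕ → ℕ → ℤ
      momentFrom i = windowSum (momentTerm A D i)

      telescope : ∀ i → i ℕ.< ℓ → i ≢ 4 → ∀ j s → Null (Y (j ℕ.+ s) i - Y s i - momentFrom i j s)
      telescope i i<ℓ i≢4 zero s = null-by (expand (Y s i)) null-0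
        where
        expand : ∀ y → y - y - + 0 ≡ + 0
        expand = solve-∀
      telescope i i<ℓ i≢4 (suc j) s with telescope i i<ℓ i≢4 j (suc s)
      ... | E rewrite ℕₚ.+-suc j s =
        null-by (expand (Y (suc (j ℕ.+ s)) i) (Y s i) (Y (suc s) i) (D s * pow (A s) i) (momentFrom i j (suc s)))
          (∣m∣n⇒∣m+n E (step s i i<ℓ i≢4))
        where
        expand : ∀ y″ y y′ f w → y″ - y - (f + w) ≡ (y″ - y′ - w) + (y′ - y - f)
        expand = solve-∀

      pairing : (ℕ → ℤ) → ℕ → ℕ → ℤ
      pairing o j s = o 0 * momentFrom 3 j s - + 3 * (o 1 * momentFrom 2 j s)
        + + 3 * (o 2 * momentFrom 1 j s) - o 3 * momentFrom 0 j s

      -- The current line is split into the starting line `o` and the displacement `v` accumulated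
      -- so far. As `ω` is linear in the line, `v` contributes the area, and `o` contributes moments
      -- with constant coefficients, collected in `pairing`; on a closed walk the latter vanish.
      telescopeArea : 4 ℕ.< ℓ → ∀ j s o v → (∀ i → i ℕ.< 4 → Null (Y s i - (o i + v i))) →
        Null (Y (j ℕ.+ s) 4 - Y s 4 - (area A D v j s + pairing o j s))
      telescopeArea 4<ℓ zero s o v _ = null-by (expand (Y s 4) (o 0) (o 1) (o 2) (o 3)) null-0
        where
        expand : ∀ y o₀ o₁ o₂ o₃ → y - y - (+ 0 +
          (o₀ * + 0 - + 3 * (o₁ * + 0) + + 3 * (o₂ * + 0) - o₃ * + 0)) ≡ + 0
        expand = solve-∀
      telescopeArea 4<ℓ (suc j) s o v E
        with telescopeArea 4<ℓ j (suc s) o (shift v (A s) (D s)) E′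
        where
        expand : ∀ y′ y o v f → y′ - (o + (v + f)) ≡ (y′ - y - f) + (y - (o + v))
        expand = solve-∀
        E′ : ∀ i → i ℕ.< 4 → Null (Y (suc s) i - (o i + shift v (A s) (D s) i))
        E′ i i<4 = null-by (expand (Y (suc s) i) (Y s i) (o i) (v i) (D s * pow (A s) i))
          (∣m∣n⇒∣m+n (step s i (ℕₚ.<-trans i<4 4<ℓ) (ℕₚ.<⇒≢ i<4)) (E i i<4))
      ... | IH rewrite ℕₚ.+-suc j s =
        null-by (expand (Y (suc (j ℕ.+ s)) 4) (Y s 4) (Y (suc s) 4) (D s) (A s) (area A D (shift v (A s) (D s)) j (suc s))
            (momentFrom 0 j (suc s)) (momentFrom 1 j (suc s)) (momentFrom 2 j (suc s)) (momentFrom 3 j (suc s))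
            (o 0) (o 1) (o 2) (o 3) (v 0) (v 1) (v 2) (v 3) (Y s 0) (Y s 1) (Y s 2) (Y s 3))
          (∣m∣n⇒∣m+n (∣m∣n⇒∣m+n IH (step₄ 4<ℓ s)) (∣n⇒∣m*n (D s) ωNull))
        where
        a = A s
        expand : ∀ y″ y y′ d a w m₀ m₁ m₂ m₃ o₀ o₁ o₂ o₃ v₀ v₁ v₂ v₃ l₀ l₁ l₂ l₃ →
          y″ - y - (d * (a * a * a * v₀ - + 3 * (a * a * v₁) + + 3 * (a * v₂) - v₃) + w
            + (o₀ * (d * (a * (a * (a * + 1))) + m₃) - + 3 * (o₁ * (d * (a * (a * + 1)) + m₂))
               + + 3 * (o₂ * (d * (a * + 1) + m₁)) - o₃ * (d * + 1 + m₀))) ≡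
          (y″ - y′ - (w + (o₀ * m₃ - + 3 * (o₁ * m₂) + + 3 * (o₂ * m₁) - o₃ * m₀)))
            + (y′ - y - d * (a * a * a * l₀ - + 3 * (a * a * l₁) + + 3 * (a * l₂) - l₃))
            + d * (a * a * a * (l₀ - (o₀ + v₀)) - + 3 * (a * a) * (l₁ - (o₁ + v₁))
               + + 3 * a * (l₂ - (o₂ + v₂)) - (l₃ - (o₃ + v₃)))
        expand = solve-∀
        ωNull = ∣m∣n⇒∣m-n (∣m∣n⇒∣m+n (∣m∣n⇒∣m-n
          (∣n⇒∣m*n (a * a * a) (E 0 (ℕ.s≤s ℕ.z≤n)))
          (∣n⇒∣m*n (+ 3 * (a * a)) (E 1 (ℕ.s≤s (ℕ.s≤s ℕ.z≤n)))))
          (∣n⇒∣m*n (+ 3 * a) (E 2 (ℕ.s≤s (ℕ.s≤s (ℕ.s≤s ℕ.z≤n))))))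
          (E 3 ℕₚ.≤-refl)

      module Closed (j : ℕ) (periodX : ∀ t → X (j ℕ.+ t) 0 ≡ X t 0) (periodY : ∀ i → Y (j ℕ.+ 0) i ≡ Y 0 i) where

        closedMoment : ∀ i → i ℕ.< ℓ → i ≢ 4 → Null (moment A D i j)
        closedMoment i i<ℓ i≢4 with telescope i i<ℓ i≢4 j 0
        ... | E rewrite periodY i = null-by (expand (Y 0 i) (moment A D i j)) (∣m⇒∣-m E)
          where
          expand : ∀ y w → w ≡ - (y - y - w)
          expand = solve-∀

        closedArea : 4 ℕ.< ℓ → Null (area A D (λ _ → + 0) j 0)
        closedArea 4<ℓ with telescopeArea 4<ℓ j 0 (Y 0) (λ _ → + 0) (λ i _ → null-by (trivial (Y 0 i)) null-0)
          where
          trivial : ∀ y → y - (y + + 0) ≡ + 0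
          trivial = solve-∀
        ... | E rewrite periodY 4 =
          null-by (expand (Y 0 4) (area A D (λ _ → + 0) j 0) (pairing (Y 0) j 0)) (∣m∣n⇒∣m-n (∣m⇒∣-m E) pairingNull)
          where
          expand : ∀ y w p → w ≡ - (y - y - (w + p)) - p
          expand = solve-∀
          m : ∀ i → i ℕ.< 4 → Null (moment A D i j)
          m i i<4 = closedMoment i (ℕₚ.<-trans i<4 4<ℓ) (ℕₚ.<⇒≢ i<4)
          pairingNull : Null (pairing (Y 0) j 0)
          pairingNull = ∣m∣n⇒∣m-n (∣m∣n⇒∣m+n (∣m∣n⇒∣m-n (∣n⇒∣m*n (Y 0 0) (m 3 ℕₚ.≤-refl))
            (∣n⇒∣m*n (+ 3) (∣n⇒∣m*n (Y 0 1) (m 2 (ℕ.s≤s (ℕ.s≤s (ℕ.s≤s ℕ.z≤n)))))))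
            (∣n⇒∣m*n (+ 3) (∣n⇒∣m*n (Y 0 2) (m 1 (ℕ.s≤s (ℕ.s≤s ℕ.z≤n))))))
            (∣n⇒∣m*n (Y 0 3) (m 0 (ℕ.s≤s ℕ.z≤n)))

    noClosedWalk : ∀ ℓ → ℓ ≡ 2 ⊎ (ℓ ≡ 3 ⊎ ℓ ≡ 5) → ¬ Null (+ 2) → ∀ X Y c on on′ movesX movesY →
      ∀ j → 1 ℕ.≤ j → j ℕ.≤ ℓ → (∀ t → X (j ℕ.+ t) 0 ≡ X t 0) → (∀ i → Y (j ℕ.+ 0) i ≡ Y 0 i) → ⊥
    noClosedWalk ℓ ℓ≡ n2 X Y c on on′ movesX movesY = go ℓ≡
      where
      open Walk ℓ X Y c on on′ movesX movesY renaming (A to a; D to d; movesX₀ to adjacent; movesY₀ to turns)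
      m : ∀ i {_ : T (i ℕ.<ᵇ ℓ)} → i ≢ 4 → ∀ {j} →
        (∀ t → X (j ℕ.+ t) 0 ≡ X t 0) → (∀ i → Y (j ℕ.+ 0) i ≡ Y 0 i) → Null (moment a d i j)
      m i {i<ℓ} i≢4 {j} pX pY = Closed.closedMoment j pX pY i (ℕₚ.<ᵇ⇒< i ℓ i<ℓ) i≢4
      single : (∀ t → X (1 ℕ.+ t) 0 ≡ X t 0) → ⊥
      single pX = adjacent 0 (subst (λ z → Null (X 0 0 - z)) (sym (pX 0)) (null-by (ℤₚ.+-inverseʳ (X 0 0)) null-0))
      -- Walks shorter than five steps are padded by steps with d = 0.
      go : ℓ ≡ 2 ⊎ (ℓ ≡ 3 ⊎ ℓ ≡ 5) → ∀ j → 1 ℕ.≤ j → j ℕ.≤ ℓ →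
        (∀ t → X (j ℕ.+ t) 0 ≡ X t 0) → (∀ i → Y (j ℕ.+ 0) i ≡ Y 0 i) → ⊥
      go _ 1 _ _ pX _ = single pX
      go (inj₁ refl) 2 _ _ pX pY = twoPoints a d (turns 0) (adjacent 1)
        (m 0 (λ ()) pX pY) (m 1 (λ ()) pX pY)
      go (inj₂ (inj₁ refl)) 2 _ _ pX pY =
        threePoints (seq (a 0) (a 1) (a 1) (a 1) (a 1)) (seq (d 0) (d 1) (+ 0) (+ 0) (+ 0))
          (turns 0) (adjacent 1) (adjacent 1)
          (m 0 (λ ()) pX pY) (m 1 (λ ()) pX pY) (m 2 (λ ()) pX pY)
      -- `adjacent 3` separates `a 2` from `X 4 0`, which the period identifies with `a 0`. The walk
      -- of five steps below closes up in the same way.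
      go (inj₂ (inj₁ refl)) 3 _ _ pX pY = threePoints a d (turns 0) (adjacent 1)
        (λ n → adjacent 3 (null-sym (X 4 0) (X 3 0) (subst (λ z → Null (z - X 3 0)) (sym (pX 1)) n)))
        (m 0 (λ ()) pX pY) (m 1 (λ ()) pX pY) (m 2 (λ ()) pX pY)
      -- The dummy point in the last place is `a 1` because it is known to differ from `a 0`, and
      -- the third place keeps `a 2` because it differs from `a 1`. The hypotheses carry over
      -- unchanged, since `+ 0 * x` computes to `+ 0`.
      go (inj₂ (inj₂ refl)) 2 _ _ pX pY =
        fivePoints (seq (a 0) (a 1) (a 2) (a 1) (a 1)) (seq (d 0) (d 1) (+ 0) (+ 0) (+ 0))
          n2 (turns 0) (turns 1) (adjacent 1) (adjacent 2) (adjacent 1)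
          (m 0 (λ ()) pX pY) (m 1 (λ ()) pX pY) (m 2 (λ ()) pX pY) (m 3 (λ ()) pX pY) (Closed.closedArea 2 pX pY ℕₚ.≤-refl)
      go (inj₂ (inj₂ refl)) 3 _ _ pX pY =
        fivePoints (seq (a 0) (a 1) (a 2) (a 1) (a 1)) (seq (d 0) (d 1) (d 2) (+ 0) (+ 0))
          n2 (turns 0) (turns 1) (adjacent 1) (adjacent 2) (adjacent 1)
          (m 0 (λ ()) pX pY) (m 1 (λ ()) pX pY) (m 2 (λ ()) pX pY) (m 3 (λ ()) pX pY) (Closed.closedArea 3 pX pY ℕₚ.≤-refl)
      go (inj₂ (inj₂ refl)) 4 _ _ pX pY =
        fivePoints (seq (a 0) (a 1) (a 2) (a 3) (a 1)) (seq (d 0) (d 1) (d 2) (d 3) (+ 0))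
          n2 (turns 0) (turns 1) (adjacent 1) (adjacent 2) (adjacent 1)
          (m 0 (λ ()) pX pY) (m 1 (λ ()) pX pY) (m 2 (λ ()) pX pY) (m 3 (λ ()) pX pY) (Closed.closedArea 4 pX pY ℕₚ.≤-refl)
      go (inj₂ (inj₂ refl)) 5 _ _ pX pY = fivePoints a d n2 (turns 0) (turns 1) (adjacent 1) (adjacent 2)
        (λ n → adjacent 5 (null-sym (X 6 0) (X 5 0) (subst (λ z → Null (z - X 5 0)) (sym (pX 1)) n)))
        (m 0 (λ ()) pX pY) (m 1 (λ ()) pX pY) (m 2 (λ ()) pX pY) (m 3 (λ ()) pX pY) (Closed.closedArea 5 pX pY ℕₚ.≤-refl)
      go (inj₁ refl) (suc (suc (suc _))) _ (ℕ.s≤s (ℕ.s≤s ()))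
      go (inj₂ (inj₁ refl)) (suc (suc (suc (suc _)))) _ (ℕ.s≤s (ℕ.s≤s (ℕ.s≤s ())))
      go (inj₂ (inj₂ refl)) (suc (suc (suc (suc (suc (suc _)))))) _ (ℕ.s≤s (ℕ.s≤s (ℕ.s≤s (ℕ.s≤s (ℕ.s≤s ())))))

open import Defs
open import Data.Bool using (true; false; if_then_else_)
import Data.Bool.Properties as Boolₚ
open import Data.Empty using (⊥; ⊥-elim)
open import Data.Fin as Fin using (Fin; zero; suc; toℕ; fromℕ<; punchIn; finToFun; funToFin)
import Data.Fin.Properties as Finₚ
open import Data.Fin.Subset using (Subset; ∣_∣; _∪_; ⁅_⁆; inside; outside) renaming (_∈_ to _∈ₛ_; ⊥ to ∅)
open import Data.Fin.Subset.Properties using (_∈?_; x∈p∪q⁺; x∈p∪q⁻; x∈⁅x⁆; x∈⁅y⁆⇒x≡y; ∉⊥)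
open import Data.Integer as ℤ using (ℤ) renaming (+_ to pos)
import Data.Integer.DivMod as ℤᵈ
import Data.Integer.Divisibility.Signed as ℤˢ
open import Data.Integer.Divisibility.Signed using (∣⇒∣ᵤ) renaming (_∣_ to _∣ᶻ_)
import Data.Integer.Properties as ℤₚ
import Data.Integer.Tactic.RingSolver as ℤSolver
open import Data.List using (List; []; _∷_; length; filter; map; foldr; allFin; upTo; _++_)
open import Data.List.Membership.Propositional using (_∈_; _∉_; lose)
open import Data.List.Membership.Propositional.Properties using (∈-filter⁺; ∈-filter⁻; ∈-map⁺; ∈-map⁻; ∈-allFin; ∈-upTo⁺; ∈-upTo⁻)
open import Data.List.Properties using (length-map; length-tabulate; length-++; filter-some)
open import Data.List.Relation.Binary.Sublist.Propositional using (_⊆_; []; _∷_; _∷ʳ_; ⊆-refl; ⊆-trans)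
import Data.List.Relation.Binary.Sublist.Propositional as Sub
open import Data.List.Relation.Binary.Sublist.Propositional.Properties using (filter-⊆; filter⁺; length-mono-≤; All-resp-⊆)
open import Data.List.Relation.Unary.All as All using (All; []; _∷_)
import Data.List.Relation.Unary.All.Properties as Allₚ
open import Data.List.Relation.Unary.AllPairs using ([]; _∷_)
open import Data.List.Relation.Unary.Any using (here; there)
open import Data.List.Relation.Unary.Unique.Propositional using (Unique)
import Data.List.Relation.Unary.Unique.Propositional.Properties as Uniqueₚ
open import Data.Nat
open import Data.Nat.Combinatorics using (_C_; nCk+nC[k+1]≡[n+1]C[k+1]; nC1≡n; k>n⇒nCk≡0)
open import Data.Nat.DivMod using (m≡m%n+[m/n]*n; m%n<n; m%n%n≡m%n; %-distribˡ-+; [m+kn]%n≡m%n)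
open import Data.Nat.Divisibility
open import Data.Nat.Induction using (<-rec)
open import Data.Nat.ListAction using (sum)
open import Data.Nat.Primality using (Prime; prime?; prime⇒nonZero; prime⇒nonTrivial)
open import Data.Nat.Primality.Factorisation using (factorise)
open import Data.Nat.Properties
open import Data.Nat.Tactic.RingSolver using (solve-∀)
open import Algebra.Properties.CommutativeMonoid.Sum +-0-commutativeMonoid using (∑-distrib-+; sum-cong-≗) renaming (sum to ∑)
open import Data.Product using (Σ; ∃; _×_; _,_; proj₁; proj₂)
open import Data.Sum using (_⊎_; inj₁; inj₂)
open import Data.Unit using (⊤; tt)
open import Data.Vec as Vec using (Vec; []; _∷_; lookup; tabulate; here; there)
import Data.Vec.Properties as Vecₚ
open import Function using (_∘_; id; flip)
open import Function.Definitions using (Injective)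
open import Relation.Binary.PropositionalEquality
open import Relation.Nullary using (¬_; Dec; yes; no; does; ¬?; _×-dec_; _→-dec_)
open ClosedWalks using (defect; module Modulo)

-- Primes between consecutive powers

primeDivisor : ∀ n → 2 ≤ n → ∃ λ p → Prime p × p ∣ n
primeDivisor n@(suc _) 2≤n with factorise n
... | record { factors = [] ; isFactorisation = eq } = ⊥-elim (<-irrefl (sym eq) 2≤n)
... | record { factors = p ∷ ps ; isFactorisation = eq ; factorsPrime = pp ∷ _ } =
  p , pp , subst (p ∣_) (sym eq) (m∣m*n _)

absorption : ∀ n m → suc m * (suc n C suc m) ≡ suc n * (n C m)
absorption zero zero = refl
absorption zero (suc m) = trans (cong (suc (suc m) *_) (k>n⇒nCk≡0 {1} {suc (suc m)} (s≤s (s≤s z≤n))))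
  (trans (*-zeroʳ m) (sym (trans (*-identityˡ (0 C suc m)) (k>n⇒nCk≡0 {0} {suc m} (s≤s z≤n)))))
absorption (suc n) zero = trans (*-identityˡ _) (trans (nC1≡n (suc (suc n))) (sym (*-identityʳ _)))
absorption (suc n) (suc m) = begin
  (2 + m) * (suc (suc n) C suc (suc m))                        ≡⟨ cong ((2 + m) *_) (sym (nCk+nC[k+1]≡[n+1]C[k+1] (suc n) (suc m))) ⟩
  (2 + m) * (suc n C suc m + suc n C suc (suc m))              ≡⟨ split (suc m) (suc n C suc m) (suc n C suc (suc m)) ⟩
  suc n C suc m + suc m * (suc n C suc m) + (2 + m) * (suc n C suc (suc m)) ≡⟨ cong₂ (λ x y → suc n C suc m + x + y) (absorption n m) (absorption n (suc m)) ⟩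
  suc n C suc m + suc n * (n C m) + suc n * (n C suc m)        ≡⟨ merge (suc n) (suc n C suc m) (n C m) (n C suc m) ⟩
  suc n C suc m + suc n * (n C m + n C suc m)                  ≡⟨ cong (λ x → suc n C suc m + suc n * x) (nCk+nC[k+1]≡[n+1]C[k+1] n m) ⟩
  suc (suc n) * (suc n C suc m) ∎
  where
  open ≡-Reasoning
  split : ∀ m x y → suc m * (x + y) ≡ x + m * x + suc m * y
  split = solve-∀
  merge : ∀ n x y z → x + n * y + n * z ≡ x + n * (y + z)
  merge = solve-∀

-- The numbers m C(n, m) are the reciprocals of the entries of Leibniz' harmonic triangle, whose entries are
-- differences of entries in the previous column.
leibniz∣ : ∀ {W N} → 1 ≤ W → (∀ k → 1 ≤ k → k ≤ N → k ∣ W) →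
  ∀ m n → suc m ≤ n → n ≤ N → suc m * (n C suc m) ∣ W
leibniz∣ {W} W>0 all zero n 1≤n n≤N =
  subst (_∣ W) (sym (trans (*-identityˡ (n C 1)) (nC1≡n n))) (all n 1≤n n≤N)
leibniz∣ {W} W>0 all (suc m) (suc n) (s≤s m<n) n<N
  with leibniz∣ W>0 all m n m<n (<⇒≤ n<N) | leibniz∣ W>0 all m (suc n) (m≤n⇒m≤1+n m<n) n<N
... | divides u W≡u | divides v W≡v = divides (u ∸ v) (sym eq)
  where
  c = n C suc m
  c′ = n C m
  pascal : suc n C suc m ≡ c′ + c
  pascal = sym (nCk+nC[k+1]≡[n+1]C[k+1] n m)
  uv : u * c ≡ v * c′ + v * c
  uv = *-cancelˡ-≡ (u * c) (v * c′ + v * c) (suc m) (begin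
    suc m * (u * c)           ≡⟨ swap (suc m) u c ⟩
    u * (suc m * c)           ≡⟨ sym W≡u ⟩
    W                         ≡⟨ W≡v ⟩
    v * (suc m * (suc n C suc m)) ≡⟨ cong (λ x → v * (suc m * x)) pascal ⟩
    v * (suc m * (c′ + c))    ≡⟨ spread (suc m) v c′ c ⟩
    suc m * (v * c′ + v * c)  ∎)
    where
    open ≡-Reasoning
    swap : ∀ m u c → m * (u * c) ≡ u * (m * c)
    swap = solve-∀
    spread : ∀ m v c′ c → v * (m * (c′ + c)) ≡ m * (v * c′ + v * c)
    spread = solve-∀
  eq : (u ∸ v) * (suc (suc m) * (suc n C suc (suc m))) ≡ W
  eq = begin
    (u ∸ v) * (suc (suc m) * (suc n C suc (suc m))) ≡⟨ cong ((u ∸ v) *_) (absorption n (suc m)) ⟩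
    (u ∸ v) * (suc n * c)   ≡⟨ swap (u ∸ v) (suc n) c ⟩
    suc n * ((u ∸ v) * c)   ≡⟨ cong (suc n *_) (trans (*-distribʳ-∸ c u v) (trans (cong (_∸ v * c) uv) (m+n∸n≡m (v * c′) (v * c)))) ⟩
    suc n * (v * c′)        ≡⟨ swap (suc n) v c′ ⟩
    v * (suc n * c′)        ≡⟨ cong (v *_) (sym (absorption n m)) ⟩
    v * (suc m * (suc n C suc m)) ≡⟨ sym W≡v ⟩
    W ∎
    where
    open ≡-Reasoning
    swap : ∀ x y z → x * (y * z) ≡ y * (x * z)
    swap = solve-∀

centralBinomial≥ : ∀ m → 2 ^ m ≤ (2 * m) C m
centralBinomial≥ zero = ≤-refl
centralBinomial≥ (suc m) = begin
  2 * 2 ^ m                                           ≤⟨ *-monoʳ-≤ 2 (centralBinomial≥ m) ⟩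
  2 * (n C m)                                         ≡⟨ double (n C m) ⟩
  n C m + n C m                                       ≤⟨ +-mono-≤ (below m) (m≤m+n (n C m) (n C suc m)) ⟩
  suc n C m + (n C m + n C suc m)                     ≡⟨ cong (suc n C m +_) (nCk+nC[k+1]≡[n+1]C[k+1] n m) ⟩
  suc n C m + suc n C suc m                           ≡⟨ nCk+nC[k+1]≡[n+1]C[k+1] (suc n) m ⟩
  suc (suc n) C suc m                                 ≡⟨ cong (_C suc m) (sym (*-suc 2 m)) ⟩
  (2 * suc m) C suc m ∎
  where
  open ≤-Reasoning
  n = 2 * m
  double : ∀ x → 2 * x ≡ x + x
  double = solve-∀
  below : ∀ k → n C k ≤ suc n C k
  below zero = ≤-refl
  below (suc k) = subst (n C suc k ≤_) (nCk+nC[k+1]≡[n+1]C[k+1] n k) (m≤n+m (n C suc k) (n C k))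

greatestPower : ∀ p → 2 ≤ p → ∀ L → ∃ λ E → p ^ E ≤ suc L × suc L < p ^ suc E
greatestPower p 2≤p zero = 0 , ≤-refl , subst (1 <_) (sym (*-identityʳ p)) 2≤p
greatestPower p 2≤p (suc L) with greatestPower p 2≤p L
... | E , lo , hi with p ^ suc E ≤? suc (suc L)
...   | no ≰ = E , m≤n⇒m≤1+n lo , ≰⇒> ≰
...   | yes le = suc E , le , ≤-<-trans hi (^-monoʳ-< p 2≤p (n<1+n (suc E)))

primePower : ∀ p → 2 ≤ p → ∀ L → 1 ≤ L → ∃ λ x → 1 ≤ x × x ≤ L × (∀ e → p ^ e ≤ L → p ^ e ∣ x)
primePower p@(suc _) 2≤p (suc L) _ with greatestPower p 2≤p L
... | E , lo , hi = p ^ E , m^n>0 p E , lo , λ e le → e∣ e (≮⇒≥ λ E<e →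
        <⇒≱ hi (≤-trans (^-monoʳ-≤ p E<e) le))
  where
  e∣ : ∀ e → e ≤ E → p ^ e ∣ p ^ E
  e∣ e e≤E = subst (p ^ e ∣_) (trans (sym (^-distribˡ-+-* p e (E ∸ e))) (cong (p ^_) (m+[n∸m]≡n e≤E))) (m∣m*n _)

factorOut : ∀ p → 2 ≤ p → ∀ m → 1 ≤ m → ∃ λ e → ∃ λ m′ → m ≡ p ^ e * m′ × ¬ p ∣ m′
factorOut p 2≤p = <-rec _ step
  where
  step : ∀ m → (∀ {k} → k < m → 1 ≤ k → ∃ λ e → ∃ λ m′ → k ≡ p ^ e * m′ × ¬ p ∣ m′) →
    1 ≤ m → ∃ λ e → ∃ λ m′ → m ≡ p ^ e * m′ × ¬ p ∣ m′
  step m rec 1≤m with p ∣? m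
  ... | no p∤m = 0 , m , sym (*-identityˡ m) , p∤m
  ... | yes (divides zero refl) = ⊥-elim (<-irrefl refl 1≤m)
  ... | yes (divides k@(suc _) refl) with rec (subst (k <_) (*-comm p k) (m<n*m 2≤p)) (s≤s z≤n)
    where
    m<n*m : 2 ≤ p → k < p * k
    m<n*m 2≤p = <-≤-trans (m<m+n k {k + 0} (s≤s z≤n)) (*-monoˡ-≤ k 2≤p)
  ...   | e , m′ , eq , ∤ = suc e , m′ , trans (cong (_* p) eq) (shuffle (p ^ e) m′ p) , ∤
    where
    shuffle : ∀ x y p → x * y * p ≡ p * x * y
    shuffle = solve-∀

-- `W` is the product, over the primes p below `B`, of the greatest power of p that is at most `L`.
-- Each factor is at most `L`; bounding the number of these primes by `B` is crude but sufficient.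
smoothMultiple : ∀ L → 1 ≤ L → ∀ B → ∃ λ W → 1 ≤ W × W ≤ L ^ B ×
  (∀ m → 1 ≤ m → m ≤ L → (∀ p → Prime p → p ∣ m → p < B) → m ∣ W)
smoothMultiple L 1≤L zero = 1 , ≤-refl , ≤-refl , isOne
  where
  isOne : ∀ m → 1 ≤ m → m ≤ L → (∀ p → Prime p → p ∣ m → p < 0) → m ∣ 1
  isOne 1 _ _ _ = ∣-refl
  isOne m@(suc (suc _)) _ _ sm with primeDivisor m (s≤s (s≤s z≤n))
  ... | p , pp , p∣m = ⊥-elim (n≮0 (sm p pp p∣m))
smoothMultiple L@(suc _) 1≤L (suc B) with smoothMultiple L 1≤L B | prime? B
... | W , 1≤W , W≤ , mult | no ¬p = W , 1≤W , ≤-trans W≤ (m≤n*m (L ^ B) L) ,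
  λ m 1≤m m≤L sm → mult m 1≤m m≤L λ p pp p∣m → ≤∧≢⇒< (≤-pred (sm p pp p∣m)) λ { refl → ¬p pp }
... | W , 1≤W , W≤ , mult | yes pB with primePower B (nonTrivial⇒n>1 B {{prime⇒nonTrivial pB}}) L 1≤L
...   | x , 1≤x , x≤L , pow∣x = x * W , *-mono-≤ 1≤x 1≤W , *-mono-≤ x≤L W≤ , mult′
  where
  mult′ : ∀ m → 1 ≤ m → m ≤ L → (∀ p → Prime p → p ∣ m → p < suc B) → m ∣ x * W
  mult′ m 1≤m m≤L sm with factorOut B (nonTrivial⇒n>1 B {{prime⇒nonTrivial pB}}) m 1≤m
  ... | e , zero , eq , ∤ = ⊥-elim (<-irrefl (sym (trans eq (*-zeroʳ (B ^ e)))) 1≤m)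
  ... | e , m′@(suc _) , refl , ∤ = *-pres-∣ (pow∣x e (≤-trans (m≤m*n (B ^ e) m′) m≤L))
    (mult m′ (s≤s z≤n) (≤-trans (m≤n*m m′ (B ^ e) {{m^n≢0 B e {{prime⇒nonZero pB}}}}) m≤L)
      λ p pp p∣m′ → ≤∧≢⇒< (≤-pred (sm p pp (∣n⇒∣m*n (B ^ e) p∣m′))) λ { refl → ∤ p∣m′ })

-- Without such a prime every number up to 2m has all its prime divisors below M, so all of them
-- divide some W ≤ (2m) ^ M. By Leibniz' triangle m C(2m, m) then divides W as well, although it is
-- at least 2 ^ m.
primeBetween : ∀ M m → 1 ≤ m → (2 * m) ^ M < 2 ^ m → ∃ λ P → Prime P × M ≤ P × P ≤ 2 * m
primeBetween M m@(suc m-1) 1≤m small with anyUpTo? (λ P → prime? P ×-dec (M ≤? P)) (suc (2 * m))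
... | yes (P , P<L , pp , M≤P) = P , pp , M≤P , ≤-pred P<L
... | no none with smoothMultiple (2 * m) (≤-trans 1≤m (m≤m+n m _)) M
...   | W , 1≤W , W≤ , mult = ⊥-elim (<⇒≱ small (begin
        2 ^ m ≤⟨ centralBinomial≥ m ⟩
        (2 * m) C m ≤⟨ m≤n*m _ m ⟩
        m * ((2 * m) C m) ≤⟨ ∣⇒≤ {{>-nonZero 1≤W}} (leibniz∣ 1≤W all m-1 (2 * m) (m≤m+n m _) ≤-refl) ⟩
        W ≤⟨ W≤ ⟩
        (2 * m) ^ M ∎))
  where
  open ≤-Reasoning
  all : ∀ k → 1 ≤ k → k ≤ 2 * m → k ∣ W
  all k@(suc _) 1≤k k≤ = mult k 1≤k k≤ λ p pp p∣k →
    ≰⇒> λ M≤p → none (p , s≤s (≤-trans (∣⇒≤ p∣k) k≤) , pp , M≤p)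

linear≤exponential : ∀ c d → c * suc (3 * c + d) ≤ 2 ^ (3 * c + d)
linear≤exponential c zero rewrite +-identityʳ (3 * c) = begin
  c * suc (3 * c)   ≤⟨ *-mono-≤ (c≤ c) (d≤ c) ⟩
  2 ^ c * 4 ^ c     ≡⟨ cong (2 ^ c *_) (^-*-assoc 2 2 c) ⟩
  2 ^ c * 2 ^ (2 * c) ≡⟨ sym (^-distribˡ-+-* 2 c (2 * c)) ⟩
  2 ^ (3 * c)       ∎
  where
  open ≤-Reasoning
  c≤ : ∀ c → c ≤ 2 ^ c
  c≤ zero = z≤n
  c≤ (suc c) = ≤-trans (+-mono-≤ (m^n>0 2 c) (c≤ c)) (+-monoʳ-≤ (2 ^ c) (m≤m+n (2 ^ c) 0))
  d≤ : ∀ c → suc (3 * c) ≤ 4 ^ c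
  d≤ zero = ≤-refl
  d≤ (suc c) = begin
    suc (3 * suc c) ≡⟨ cong suc (*-suc 3 c) ⟩
    suc (3 + 3 * c) ≤⟨ m≤m+n _ (9 * c) ⟩
    suc (3 + 3 * c) + 9 * c ≡⟨ collect c ⟩
    4 * suc (3 * c) ≤⟨ *-monoʳ-≤ 4 (d≤ c) ⟩
    4 ^ suc c ∎
    where
    collect : ∀ c → suc (3 + 3 * c) + 9 * c ≡ 4 * suc (3 * c)
    collect = solve-∀
linear≤exponential c (suc d) rewrite +-suc (3 * c) d = begin
  c * suc (suc h) ≡⟨ *-suc c (suc h) ⟩
  c + c * suc h ≤⟨ +-monoˡ-≤ (c * suc h) (m≤m*n c (suc h)) ⟩
  c * suc h + c * suc h ≤⟨ +-mono-≤ (linear≤exponential c d) (linear≤exponential c d) ⟩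
  2 ^ h + 2 ^ h ≡⟨ cong (2 ^ h +_) (sym (+-identityʳ (2 ^ h))) ⟩
  2 ^ suc h ∎
  where
  open ≤-Reasoning
  h = 3 * c + d

power<exponential : ∀ K → ∃ λ g₀ → ∀ g → g₀ ≤ g → (2 * g) ^ suc K < 2 ^ g
-- The exponent `g` contains `K` blocks of length `h = g / K`, so `2 * g < 2 ^ h` suffices. The
-- threshold ensures `3 * (2 * K) ≤ h`, the range of `linear≤exponential` at `c = 2 * K`.
power<exponential K′ = 3 * (2 * K) * K , bound
  where
  K = suc K′
  bound : ∀ g → 3 * (2 * K) * K ≤ g → (2 * g) ^ K < 2 ^ g
  bound g g₀≤g = <-≤-trans (^-monoˡ-< K 2g<2^h) (begin
    (2 ^ h) ^ K ≡⟨ ^-*-assoc 2 h K ⟩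
    2 ^ (h * K) ≤⟨ ^-monoʳ-≤ 2 (subst (h * K ≤_) (sym (m≡m%n+[m/n]*n g K)) (m≤n+m (h * K) (g % K))) ⟩
    2 ^ g ∎)
    where
    open ≤-Reasoning
    h = g / K
    g<K[h+1] : g < K * suc h
    g<K[h+1] = begin-strict
      g ≡⟨ m≡m%n+[m/n]*n g K ⟩
      g % K + h * K <⟨ +-monoˡ-< (h * K) (m%n<n g K) ⟩
      K + h * K ≡⟨ *-comm (suc h) K ⟩
      K * suc h ∎
    c≤h : 3 * (2 * K) ≤ h
    c≤h = ≤-pred (*-cancelʳ-< K (3 * (2 * K)) (suc h) (≤-<-trans g₀≤g (subst (g <_) (*-comm K (suc h)) g<K[h+1])))
    2g<2^h : 2 * g < 2 ^ h
    2g<2^h = begin-strict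
      2 * g <⟨ *-monoʳ-< 2 g<K[h+1] ⟩
      2 * (K * suc h) ≡⟨ sym (*-assoc 2 K (suc h)) ⟩
      2 * K * suc h ≡⟨ cong (λ z → 2 * K * suc z) (sym (m+[n∸m]≡n c≤h)) ⟩
      2 * K * suc (3 * (2 * K) + (h ∸ 3 * (2 * K))) ≤⟨ linear≤exponential (2 * K) (h ∸ 3 * (2 * K)) ⟩
      2 ^ (3 * (2 * K) + (h ∸ 3 * (2 * K))) ≡⟨ cong (2 ^_) (m+[n∸m]≡n c≤h) ⟩
      2 ^ h ∎

-- With M = (2g) ^ k and m = gM, both sides of the condition of `primeBetween` are M-th powers, and
-- it reduces to (2g) ^ (k + 1) < 2 ^ g. The interval is far longer than in Bertrand's postulate,
-- but its ends differ only by a factor 1 + 1 / k in the exponent, which the o(1) absorbs.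
primeBetweenPowers : ∀ k → ∃ λ g₀ → ∀ g → g₀ ≤ g → 1 ≤ g →
  ∃ λ P → Prime P × (2 * g) ^ k ≤ P × P ≤ (2 * g) ^ suc k
primeBetweenPowers k with power<exponential k
... | g₀ , bound = g₀ , λ g g₀≤g 1≤g → between g (bound g g₀≤g) 1≤g
  where
  between : ∀ g → (2 * g) ^ suc k < 2 ^ g → 1 ≤ g → ∃ λ P → Prime P × (2 * g) ^ k ≤ P × P ≤ (2 * g) ^ suc k
  between g@(suc _) small 1≤g = subst (λ L → ∃ λ P → Prime P × M ≤ P × P ≤ L) (*-assoc′ g M)
    (primeBetween M (g * M) (*-mono-≤ 1≤g (m^n>0 (2 * g) k)) (begin-strict
      (2 * (g * M)) ^ M ≡⟨ cong (_^ M) (*-assoc′ g M) ⟩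
      ((2 * g) ^ suc k) ^ M <⟨ ^-monoˡ-< M {{m^n≢0 (2 * g) k}} small ⟩
      (2 ^ g) ^ M ≡⟨ ^-*-assoc 2 g M ⟩
      2 ^ (g * M) ∎))
    where
    open ≤-Reasoning
    M = (2 * g) ^ k
    *-assoc′ : ∀ g M → 2 * (g * M) ≡ 2 * g * M
    *-assoc′ = solve-∀

-- Averaging over vectors

𝟙 : ∀ {p} {P : Set p} → Dec P → ℕ
𝟙 d = if does d then 1 else 0

𝟙-yes : ∀ {p} {P : Set p} (d : Dec P) → P → 𝟙 d ≡ 1
𝟙-yes (yes _) _ = refl
𝟙-yes (no ¬p) p = ⊥-elim (¬p p)

𝟙-no : ∀ {p} {P : Set p} (d : Dec P) → ¬ P → 𝟙 d ≡ 0
𝟙-no (no _) _ = refl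
𝟙-no (yes p) ¬p = ⊥-elim (¬p p)

∑-const : ∀ N k → ∑ {N} (λ _ → k) ≡ N * k
∑-const zero k = refl
∑-const (suc N) k = cong (k +_) (∑-const N k)

∑-mono : ∀ {N} {f g : Fin N → ℕ} → (∀ i → f i ≤ g i) → ∑ f ≤ ∑ g
∑-mono {zero} _ = z≤n
∑-mono {suc N} le = +-mono-≤ (le zero) (∑-mono (le ∘ suc))

∑-term : ∀ {N} (f : Fin N → ℕ) i → f i ≤ ∑ f
∑-term f zero = m≤m+n (f zero) _
∑-term f (suc i) = ≤-trans (∑-term (f ∘ suc) i) (m≤n+m _ (f zero))

∑-*ˡ : ∀ {N} k (f : Fin N → ℕ) → k * ∑ f ≡ ∑ (λ i → k * f i)
∑-*ˡ {zero} k f = *-zeroʳ k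
∑-*ˡ {suc N} k f = trans (*-distribˡ-+ k (f zero) _) (cong (k * f zero +_) (∑-*ˡ k (f ∘ suc)))

∑-𝟙 : ∀ {N} (j : Fin N) → ∑ (λ c → 𝟙 (c Fin.≟ j)) ≡ 1
∑-𝟙 {suc N} zero = cong suc (trans (∑-const N 0) (*-zeroʳ N))
∑-𝟙 {suc N} (suc j) = trans (sum-cong-≗ same) (∑-𝟙 j)
  where
  same : ∀ c → 𝟙 (suc c Fin.≟ suc j) ≡ 𝟙 (c Fin.≟ j)
  same c with c Fin.≟ j
  ... | yes _ = refl
  ... | no _ = refl

total : ∀ {N} n → (Vec (Fin N) n → ℕ) → ℕ
total zero F = F []
total (suc n) F = ∑ λ c → total n λ h → F (c ∷ h)

module _ {N : ℕ} where

  total-cong : ∀ n {F G : Vec (Fin N) n → ℕ} → (∀ h → F h ≡ G h) → total n F ≡ total n G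
  total-cong zero eq = eq []
  total-cong (suc n) eq = sum-cong-≗ λ c → total-cong n λ h → eq (c ∷ h)

  total-+ : ∀ n (F G : Vec (Fin N) n → ℕ) → total n (λ h → F h + G h) ≡ total n F + total n G
  total-+ zero F G = refl
  total-+ (suc n) F G = trans (sum-cong-≗ λ c → total-+ n (F ∘ (c ∷_)) (G ∘ (c ∷_)))
    (∑-distrib-+ {N} (λ c → total n (F ∘ (c ∷_))) (λ c → total n (G ∘ (c ∷_))))

  total-const : ∀ n k → total {N} n (λ _ → k) ≡ N ^ n * k
  total-const zero k = sym (*-identityˡ k)
  total-const (suc n) k = trans (sum-cong-≗ {N} λ _ → total-const n k)
    (trans (∑-const N (N ^ n * k)) (sym (*-assoc N (N ^ n) k)))

  total-term : ∀ n (F : Vec (Fin N) n → ℕ) h → F h ≤ total n F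
  total-term zero F [] = ≤-refl
  total-term (suc n) F (c ∷ h) = ≤-trans (total-term n (F ∘ (c ∷_)) h) (∑-term (λ c → total n (F ∘ (c ∷_))) c)

  total-sum : ∀ {A : Set} n (F : A → Vec (Fin N) n → ℕ) xs →
    total n (λ h → sum (map (λ x → F x h) xs)) ≡ sum (map (λ x → total n (F x)) xs)
  total-sum n F [] = trans (total-const n 0) (*-zeroʳ (N ^ n))
  total-sum n F (x ∷ xs) = trans (total-+ n (F x) _) (cong (total n (F x) +_) (total-sum n F xs))

  total-collision : ∀ n (v w : Fin n) → v ≢ w → N * total {N} n (λ h → 𝟙 (lookup h v Fin.≟ lookup h w)) ≡ N ^ n
  total-collision (suc n) zero zero v≢w = ⊥-elim (v≢w refl)
  total-collision (suc n) zero (suc w) _ = cong (N *_) (trans (swap n _)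
    (trans (total-cong n λ h → ∑-𝟙 (lookup h w)) (trans (total-const n 1) (*-identityʳ _))))
    where
    swap : ∀ n (F : Fin N → Vec (Fin N) n → ℕ) → ∑ (λ c → total n (F c)) ≡ total n (λ h → ∑ (λ c → F c h))
    swap n F = go F
      where
      go : ∀ {M} (F : Fin M → Vec (Fin N) n → ℕ) → ∑ (λ c → total n (F c)) ≡ total n (λ h → ∑ (λ c → F c h))
      go {zero} F = sym (trans (total-const n 0) (*-zeroʳ (N ^ n)))
      go {suc M} F = trans (cong (total n (F zero) +_) (go (F ∘ suc))) (sym (total-+ n (F zero) _))
  total-collision (suc n) (suc v) zero _ = trans (cong (N *_) (total-cong (suc n) λ h → flipped (lookup h (suc v)) (lookup h zero)))
    (total-collision (suc n) zero (suc v) λ ())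
    where
    flipped : ∀ (a b : Fin N) → 𝟙 (a Fin.≟ b) ≡ 𝟙 (b Fin.≟ a)
    flipped a b with a Fin.≟ b
    ... | yes refl = sym (𝟙-yes (a Fin.≟ a) refl)
    ... | no a≢b = sym (𝟙-no (b Fin.≟ a) (a≢b ∘ sym))
  total-collision (suc n) (suc v) (suc w) v≢w = trans
    (cong (N *_) (∑-const N (total n (λ h → 𝟙 (lookup h v Fin.≟ lookup h w)))))
    (cong (N *_) (total-collision n v w (v≢w ∘ cong suc)))

-- Conditional expectations: the entries of a vector are fixed one by one, never worsening the
-- average over the remaining ones. The order is abstract so that one argument yields a vector at
-- most the average for `_≤_` and one at least the average for `_≥_`.
module Averaging (_⊑_ : ℕ → ℕ → Set) (refl⊑ : ∀ {x} → x ⊑ x) (trans⊑ : ∀ {x y z} → x ⊑ y → y ⊑ z → x ⊑ z)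
  (total⊑ : ∀ x y → x ⊑ y ⊎ y ⊑ x) (+-mono-⊑ : ∀ {x y u v} → x ⊑ y → u ⊑ v → (x + u) ⊑ (y + v)) where

  *-mono-⊑ : ∀ k {x y} → x ⊑ y → (k * x) ⊑ (k * y)
  *-mono-⊑ zero _ = refl⊑
  *-mono-⊑ (suc k) le = +-mono-⊑ le (*-mono-⊑ k le)

  bestTerm : ∀ N .{{_ : NonZero N}} (f : Fin N → ℕ) → ∃ λ c → (N * f c) ⊑ ∑ f
  bestTerm (suc zero) f = zero , refl⊑
  bestTerm (suc (suc N)) f with bestTerm (suc N) (f ∘ suc)
  ... | c , le with total⊑ (f zero) (f (suc c))
  ...   | inj₁ lo = zero , +-mono-⊑ {f zero} refl⊑ (trans⊑ (*-mono-⊑ (suc N) lo) le)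
  ...   | inj₂ hi = suc c , +-mono-⊑ hi le

  best : ∀ {N} .{{_ : NonZero N}} n (F : Vec (Fin N) n → ℕ) → ∃ λ h → (N ^ n * F h) ⊑ total n F
  best zero F = [] , subst (_⊑ F []) (sym (*-identityˡ (F []))) refl⊑
  best {N} (suc n) F with bestTerm N (λ c → total n (F ∘ (c ∷_)))
  ... | c , le with best n (F ∘ (c ∷_))
  ...   | h , le′ = c ∷ h , trans⊑ (subst (_⊑ (N * total n (F ∘ (c ∷_)))) (sym (*-assoc N (N ^ n) (F (c ∷ h)))) (*-mono-⊑ N le′)) le

open Averaging _≤_ ≤-refl ≤-trans ≤-total +-mono-≤ using () renaming (best to smallest)
open Averaging _≥_ ≤-refl (flip ≤-trans) (flip ≤-total) +-mono-≤ using () renaming (best to largest)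

sum-mono : ∀ {A : Set} (f g : A → ℕ) xs → (∀ x → x ∈ xs → f x ≤ g x) → sum (map f xs) ≤ sum (map g xs)
sum-mono f g [] _ = z≤n
sum-mono f g (x ∷ xs) le = +-mono-≤ (le x (here refl)) (sum-mono f g xs λ y y∈ → le y (there y∈))

sum-const : ∀ {A : Set} k (xs : List A) → sum (map (λ _ → k) xs) ≡ length xs * k
sum-const k [] = refl
sum-const k (x ∷ xs) = cong (k +_) (sum-const k xs)

sum-*ˡ : ∀ {A : Set} k (f : A → ℕ) xs → k * sum (map f xs) ≡ sum (map (λ x → k * f x) xs)
sum-*ˡ k f [] = *-zeroʳ k
sum-*ˡ k f (x ∷ xs) = trans (*-distribˡ-+ k (f x) _) (cong (k * f x +_) (sum-*ˡ k f xs))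

length-filter-𝟙 : ∀ {A : Set} {P : A → Set} (P? : ∀ x → Dec (P x)) xs → length (filter P? xs) ≡ sum (map (𝟙 ∘ P?) xs)
length-filter-𝟙 P? [] = refl
length-filter-𝟙 P? (x ∷ xs) with does (P? x)
... | true = cong suc (length-filter-𝟙 P? xs)
... | false = length-filter-𝟙 P? xs

popular : ∀ {A : Set} {N} .{{_ : NonZero N}} n {R : A → Vec (Fin N) n → Set} (R? : ∀ x h → Dec (R x h)) K xs →
  (∀ x → x ∈ xs → N ^ n ≤ K * total n (λ h → 𝟙 (R? x h))) →
  ∃ λ h → length xs ≤ K * length (filter (λ x → R? x h) xs)
popular {N = N} n R? K xs often with largest {N} n (λ h → length (filter (λ x → R? x h) xs))
... | h , large = h , *-cancelʳ-≤ (length xs) (K * length (filter (λ x → R? x h) xs)) (N ^ n) {{m^n≢0 N n}} (begin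
  length xs * N ^ n                                       ≡⟨ sym (sum-const (N ^ n) xs) ⟩
  sum (map (λ _ → N ^ n) xs)                              ≤⟨ sum-mono _ _ xs often ⟩
  sum (map (λ x → K * total n (λ h → 𝟙 (R? x h))) xs)         ≡⟨ sym (sum-*ˡ K _ xs) ⟩
  K * sum (map (λ x → total n (λ h → 𝟙 (R? x h))) xs)         ≡⟨ cong (K *_) (sym (total-sum n (λ x h → 𝟙 (R? x h)) xs)) ⟩
  K * total n (λ h → sum (map (λ x → 𝟙 (R? x h)) xs))         ≡⟨ cong (K *_) (total-cong n λ h → sym (length-filter-𝟙 (λ x → R? x h) xs)) ⟩
  K * total n (λ h → length (filter (λ x → R? x h) xs))       ≤⟨ *-monoʳ-≤ K large ⟩
  K * (N ^ n * length (filter (λ x → R? x h) xs))         ≡⟨ shuffle K (N ^ n) _ ⟩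
  K * length (filter (λ x → R? x h) xs) * N ^ n           ∎)
  where
  open ≤-Reasoning
  shuffle : ∀ k m x → k * (m * x) ≡ k * x * m
  shuffle = solve-∀

pigeonhole : ∀ {A : Set} {N} .{{_ : NonZero N}} n (κ : A → Vec (Fin N) n) xs →
  ∃ λ s → length xs ≤ N ^ n * length (filter (λ x → Vecₚ.≡-dec Fin._≟_ (κ x) s) xs)
pigeonhole {N = N} n κ xs = popular n (λ x s → Vecₚ.≡-dec Fin._≟_ (κ x) s) (N ^ n) xs λ x _ →
  m≤m*n′ (N ^ n) (subst (_≤ total n (λ s → 𝟙 (Vecₚ.≡-dec Fin._≟_ (κ x) s)))
    (𝟙-yes (Vecₚ.≡-dec Fin._≟_ (κ x) (κ x)) refl) (total-term n (λ s → 𝟙 (Vecₚ.≡-dec Fin._≟_ (κ x) s)) (κ x)))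
  where
  m≤m*n′ : ∀ m {n} → 1 ≤ n → m ≤ m * n
  m≤m*n′ m {n} 1≤n = subst (_≤ m * n) (*-identityʳ m) (*-monoʳ-≤ m 1≤n)

Separates : ∀ {N n} → Vec (Fin N) n → List (Fin n × Fin n) → Set
Separates h = All λ (v , w) → lookup h v ≢ lookup h w

separates? : ∀ {N n} (h : Vec (Fin N) n) ps → Dec (Separates h ps)
separates? h = All.all? λ (v , w) → ¬? (lookup h v Fin.≟ lookup h w)

collisions : ∀ {N n} → Vec (Fin N) n → List (Fin n × Fin n) → ℕ
collisions h ps = sum (map (λ (v , w) → 𝟙 (lookup h v Fin.≟ lookup h w)) ps)

separates∨collision : ∀ {N n} (h : Vec (Fin N) n) ps → 1 ≤ 𝟙 (separates? h ps) + collisions h ps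
separates∨collision h ps with separates? h ps
... | yes _ = s≤s z≤n
... | no ¬sep = go ps ¬sep
  where
  go : ∀ ps → ¬ Separates h ps → 1 ≤ collisions h ps
  go [] ¬sep = ⊥-elim (¬sep [])
  go ((v , w) ∷ ps) ¬sep with lookup h v Fin.≟ lookup h w
  ... | yes _ = s≤s z≤n
  ... | no ≢ = go ps (¬sep ∘ (≢ ∷_))

-- First moment: a random `h` identifies a given pair with probability 1 / N, so an item suffers at
-- most k / N ≤ 1 / 2 collisions on average. Some `h` has at most half as many collisions as there
-- are items, and each spoiled item accounts for at least one.
separate : ∀ {A : Set} {N n} .{{_ : NonZero N}} (conflicts : A → List (Fin n × Fin n)) xs k .{{_ : NonZero k}} → 2 * k ≤ N →
  (∀ x → x ∈ xs → length (conflicts x) ≤ k × All (λ (v , w) → v ≢ w) (conflicts x)) →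
  ∃ λ (h : Vec (Fin N) n) → length xs ≤ 2 * length (filter (λ x → separates? h (conflicts x)) xs)
separate {A} {N} {n} conflicts xs k 2k≤N conf with smallest {N} n (λ h → sum (map (λ x → collisions h (conflicts x)) xs))
... | h , small = h , result
  where
  open ≤-Reasoning
  bad good : ℕ
  bad = sum (map (λ x → collisions h (conflicts x)) xs)
  good = length (filter (λ x → separates? h (conflicts x)) xs)
  expected : ∀ ps → All (λ (v , w) → v ≢ w) ps → N * total n (λ h → collisions h ps) ≡ length ps * N ^ n
  expected ps distinct = trans (cong (N *_) (total-sum n (λ (v , w) h → 𝟙 (lookup h v Fin.≟ lookup h w)) ps))
    (trans (sum-*ˡ N _ ps) (each ps distinct))
    where
    each : ∀ ps → All (λ (v , w) → v ≢ w) ps →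
      sum (map (λ (v , w) → N * total n (λ h → 𝟙 (lookup h v Fin.≟ lookup h w))) ps) ≡ length ps * N ^ n
    each [] [] = refl
    each ((v , w) ∷ ps) (v≢w ∷ d) = cong₂ _+_ (total-collision n v w v≢w) (each ps d)
  N*bad : N * bad ≤ length xs * k
  N*bad = *-cancelʳ-≤ (N * bad) (length xs * k) (N ^ n) {{m^n≢0 N n}} (begin
    N * bad * N ^ n ≡⟨ shuffle N bad (N ^ n) ⟩
    N * (N ^ n * bad) ≤⟨ *-monoʳ-≤ N small ⟩
    N * total n (λ h → sum (map (λ x → collisions h (conflicts x)) xs)) ≡⟨ cong (N *_) (total-sum n (λ x h → collisions h (conflicts x)) xs) ⟩
    N * sum (map (λ x → total n (λ h → collisions h (conflicts x))) xs) ≡⟨ sum-*ˡ N _ xs ⟩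
    sum (map (λ x → N * total n (λ h → collisions h (conflicts x))) xs) ≤⟨ sum-mono _ _ xs (λ x x∈ →
      ≤-trans (≤-reflexive (expected (conflicts x) (proj₂ (conf x x∈)))) (*-monoˡ-≤ (N ^ n) (proj₁ (conf x x∈)))) ⟩
    sum (map (λ _ → k * N ^ n) xs) ≡⟨ sum-const (k * N ^ n) xs ⟩
    length xs * (k * N ^ n) ≡⟨ sym (*-assoc (length xs) k (N ^ n)) ⟩
    length xs * k * N ^ n ∎)
    where
    shuffle : ∀ a b c → a * b * c ≡ a * (c * b)
    shuffle = solve-∀
  2bad : 2 * bad ≤ length xs
  2bad = *-cancelʳ-≤ (2 * bad) (length xs) k (begin
    2 * bad * k ≡⟨ shuffle bad k ⟩
    2 * k * bad ≤⟨ *-monoˡ-≤ bad 2k≤N ⟩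
    N * bad ≤⟨ N*bad ⟩
    length xs * k ∎)
    where
    shuffle : ∀ b k → 2 * b * k ≡ 2 * k * b
    shuffle = solve-∀
  cover : length xs ≤ good + bad
  cover = subst (λ z → length xs ≤ z + bad) (sym (length-filter-𝟙 (λ x → separates? h (conflicts x)) xs)) (go xs)
    where
    go : ∀ xs → length xs ≤ sum (map (λ x → 𝟙 (separates? h (conflicts x))) xs) + sum (map (λ x → collisions h (conflicts x)) xs)
    go [] = z≤n
    go (x ∷ xs) = ≤-trans (+-mono-≤ (separates∨collision h (conflicts x)) (go xs))
      (≤-reflexive (interchange (𝟙 (separates? h (conflicts x))) (collisions h (conflicts x)) _ _))
      where
      interchange : ∀ a b c d → a + b + (c + d) ≡ a + c + (b + d)
      interchange = solve-∀
  result : length xs ≤ 2 * good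
  result = +-cancelʳ-≤ (length xs) (length xs) (2 * good) (begin
    length xs + length xs ≤⟨ +-mono-≤ cover cover ⟩
    (good + bad) + (good + bad) ≡⟨ regroup good bad ⟩
    2 * good + 2 * bad ≤⟨ +-monoʳ-≤ (2 * good) 2bad ⟩
    2 * good + length xs ∎)
    where
    regroup : ∀ g b → (g + b) + (g + b) ≡ 2 * g + 2 * b
    regroup = solve-∀

-- Rainbow edges and codegrees

-- The members of the edge receive the colours j, j + 1, ... in the order of the vertices.
-- Prescribing this one rainbow pattern, instead of allowing all permutations, makes the frequency
-- computable by recursion and costs only a constant.
Ordered : ∀ {r n} → ℕ → Subset n → Vec (Fin r) n → Set
Ordered j [] [] = ⊤
Ordered j (outside ∷ e) (c ∷ χ) = Ordered j e χ
Ordered j (inside ∷ e) (c ∷ χ) = toℕ c ≡ j × Ordered (suc j) e χ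

ordered? : ∀ {r n} j (e : Subset n) (χ : Vec (Fin r) n) → Dec (Ordered j e χ)
ordered? j [] [] = yes tt
ordered? j (outside ∷ e) (c ∷ χ) = ordered? j e χ
ordered? j (inside ∷ e) (c ∷ χ) = (toℕ c ≟ j) ×-dec ordered? (suc j) e χ

ordered-frequency : ∀ {r n} j (e : Subset n) → j + ∣ e ∣ ≤ r →
  r ^ n ≤ r ^ ∣ e ∣ * total {r} n (λ χ → 𝟙 (ordered? j e χ))
ordered-frequency j [] _ = ≤-refl
ordered-frequency {r} {suc n} j (outside ∷ e) j+e≤r = begin
  r * r ^ n           ≤⟨ *-monoʳ-≤ r (ordered-frequency j e j+e≤r) ⟩
  r * (r ^ ∣ e ∣ * t) ≡⟨ shuffle r (r ^ ∣ e ∣) t ⟩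
  r ^ ∣ e ∣ * (r * t) ≡⟨ cong (r ^ ∣ e ∣ *_) (sym (∑-const r t)) ⟩
  r ^ ∣ e ∣ * total {r} (suc n) (λ χ → 𝟙 (ordered? j (outside ∷ e) χ)) ∎
  where
  open ≤-Reasoning
  t = total {r} n (λ χ → 𝟙 (ordered? j e χ))
  shuffle : ∀ a b c → a * (b * c) ≡ b * (a * c)
  shuffle = solve-∀
ordered-frequency {r} {suc n} j (inside ∷ e) j+e≤r = begin
  r * r ^ n           ≤⟨ *-monoʳ-≤ r (ordered-frequency (suc j) e (subst (_≤ r) (+-suc j ∣ e ∣) j+e≤r)) ⟩
  r * (r ^ ∣ e ∣ * t) ≡⟨ sym (*-assoc r (r ^ ∣ e ∣) t) ⟩
  r * r ^ ∣ e ∣ * t   ≡⟨ cong (r * r ^ ∣ e ∣ *_) (total-cong n (same ∘ id)) ⟩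
  r * r ^ ∣ e ∣ * f c ≤⟨ *-monoʳ-≤ (r * r ^ ∣ e ∣) (∑-term f c) ⟩
  r * r ^ ∣ e ∣ * total {r} (suc n) (λ χ → 𝟙 (ordered? j (inside ∷ e) χ)) ∎
  where
  open ≤-Reasoning
  t = total {r} n (λ χ → 𝟙 (ordered? (suc j) e χ))
  f : Fin r → ℕ
  f c = total {r} n (λ χ → 𝟙 (ordered? j (inside ∷ e) (c ∷ χ)))
  j<r : j < r
  j<r = ≤-trans (s≤s (m≤m+n j ∣ e ∣)) (subst (_≤ r) (+-suc j ∣ e ∣) j+e≤r)
  c = fromℕ< j<r
  same : ∀ χ → 𝟙 (ordered? (suc j) e χ) ≡ 𝟙 (ordered? j (inside ∷ e) (c ∷ χ))
  same χ with ordered? (suc j) e χ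
  ... | yes o = sym (𝟙-yes ((toℕ c ≟ j) ×-dec yes o) (Finₚ.toℕ-fromℕ< j<r , o))
  ... | no ¬o = sym (𝟙-no ((toℕ c ≟ j) ×-dec no ¬o) (¬o ∘ proj₂))

record Rainbow {r n} (χ : Vec (Fin r) n) (e : Subset n) : Set where
  field
    has    : ∀ c → ∃ λ v → v ∈ₛ e × lookup χ v ≡ c
    unique : ∀ {v w} → v ∈ₛ e → w ∈ₛ e → lookup χ v ≡ lookup χ w → v ≡ w

ordered⇒rainbow : ∀ {r n} {χ : Vec (Fin r) n} {e} → ∣ e ∣ ≡ r → Ordered 0 e χ → Rainbow χ e
ordered⇒rainbow {r} {n} {χ} {e} size o = record
  { has = λ c → has 0 e χ o c z≤n (subst (toℕ c <_) (sym size) (Finₚ.toℕ<n c))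
  ; unique = unique 0 e χ o }
  where
  has : ∀ {n} j (e : Subset n) χ → Ordered j e χ → ∀ (c : Fin r) → j ≤ toℕ c → toℕ c < j + ∣ e ∣ →
    ∃ λ v → v ∈ₛ e × lookup χ v ≡ c
  has j [] [] o c j≤c c< = ⊥-elim (<⇒≱ c< (subst (_≤ toℕ c) (sym (+-identityʳ j)) j≤c))
  has j (outside ∷ e) (d ∷ χ) o c j≤c c< with has j e χ o c j≤c c<
  ... | v , v∈ , eq = suc v , there v∈ , eq
  has j (inside ∷ e) (d ∷ χ) (d≡j , o) c j≤c c< with toℕ c ≟ j
  ... | yes c≡j = zero , here , Finₚ.toℕ-injective (trans d≡j (sym c≡j))
  ... | no c≢j with has (suc j) e χ o c (≤∧≢⇒< j≤c (c≢j ∘ sym)) (subst (toℕ c <_) (+-suc j ∣ e ∣) c<)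
  ...   | v , v∈ , eq = suc v , there v∈ , eq
  late : ∀ {n} j (e : Subset n) (χ : Vec (Fin r) n) → Ordered j e χ → ∀ {v} → v ∈ₛ e → j ≤ toℕ (lookup χ v)
  late j (outside ∷ e) (d ∷ χ) o (there v∈) = late j e χ o v∈
  late j (inside ∷ e) (d ∷ χ) (d≡j , o) here = ≤-reflexive (sym d≡j)
  late j (inside ∷ e) (d ∷ χ) (d≡j , o) (there v∈) = <⇒≤ (late (suc j) e χ o v∈)
  unique : ∀ {n} j (e : Subset n) (χ : Vec (Fin r) n) → Ordered j e χ → ∀ {v w} → v ∈ₛ e → w ∈ₛ e → lookup χ v ≡ lookup χ w → v ≡ w
  unique j (outside ∷ e) (d ∷ χ) o (there v∈) (there w∈) eq = cong suc (unique j e χ o v∈ w∈ eq)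
  unique j (inside ∷ e) (d ∷ χ) (d≡j , o) here here eq = refl
  unique j (inside ∷ e) (d ∷ χ) (d≡j , o) here (there w∈) eq =
    ⊥-elim (<-irrefl (trans (sym d≡j) (cong toℕ eq)) (late (suc j) e χ o w∈))
  unique j (inside ∷ e) (d ∷ χ) (d≡j , o) (there v∈) here eq =
    ⊥-elim (<-irrefl (trans (sym d≡j) (cong toℕ (sym eq))) (late (suc j) e χ o v∈))
  unique j (inside ∷ e) (d ∷ χ) (d≡j , o) (there v∈) (there w∈) eq = cong suc (unique (suc j) e χ o v∈ w∈ eq)

rainbowSubgraph : ∀ r {n} (H : EdgeList n) → All (λ e → ∣ e ∣ ≡ suc r) H →
  ∃ λ (χ : Vec (Fin (suc r)) n) → ∃ λ G → G ⊆ H × All (Rainbow χ) G × length H ≤ suc r ^ suc r * length G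
rainbowSubgraph r {n} H sizes with popular n (λ e χ → ordered? 0 e χ) (suc r ^ suc r) H often
  where
  often : ∀ e → e ∈ H → suc r ^ n ≤ suc r ^ suc r * total n (λ χ → 𝟙 (ordered? 0 e χ))
  often e e∈ with All.lookup sizes e∈
  ... | size = subst (λ k → suc r ^ n ≤ suc r ^ k * total n (λ χ → 𝟙 (ordered? 0 e χ))) size
    (ordered-frequency 0 e (≤-reflexive size))
... | χ , large = χ , filter P? H , filter-⊆ P? H , All.tabulate rainbow , large
  where
  P? = λ e → ordered? 0 e χ
  rainbow : ∀ {e} → e ∈ filter P? H → Rainbow χ e
  rainbow e∈ with ∈-filter⁻ P? {xs = H} e∈
  ... | e∈H , o = ordered⇒rainbow (All.lookup sizes e∈H) o

filter-split : ∀ {A : Set} {P Q : A → Set} (P? : ∀ x → Dec (P x)) (Q? : ∀ x → Dec (Q x)) → (∀ {x} → P x → Q x) → ∀ xs →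
  length (filter P? xs) + length (filter (λ x → Q? x ×-dec ¬? (P? x)) xs) ≡ length (filter Q? xs)
filter-split P? Q? P⇒Q [] = refl
filter-split P? Q? P⇒Q (x ∷ xs) with P? x | Q? x
... | yes p | yes _ = cong suc (filter-split P? Q? P⇒Q xs)
... | yes p | no ¬q = ⊥-elim (¬q (P⇒Q p))
... | no _ | yes _ = trans (+-suc _ _) (cong suc (filter-split P? Q? P⇒Q xs))
... | no _ | no _ = filter-split P? Q? P⇒Q xs

filter-complement : ∀ {A : Set} {P : A → Set} (P? : ∀ x → Dec (P x)) xs →
  length (filter (¬? ∘ P?) xs) + length (filter P? xs) ≡ length xs
filter-complement P? [] = refl
filter-complement P? (x ∷ xs) with P? x
... | yes _ = trans (+-suc _ _) (cong suc (filter-complement P? xs))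
... | no _ = cong suc (filter-complement P? xs)

lookup-extensional : ∀ {A : Set} {n} {xs ys : Vec A n} → (∀ i → lookup xs i ≡ lookup ys i) → xs ≡ ys
lookup-extensional {xs = xs} {ys} eq = trans (sym (Vecₚ.tabulate∘lookup xs)) (trans (Vecₚ.tabulate-cong eq) (Vecₚ.tabulate∘lookup ys))

disjointFibres : ∀ {A B : Set} {R : A → B → Set} {Q : B → Set} (R? : ∀ x y → Dec (R x y)) (Q? : ∀ y → Dec (Q y)) m xs ys →
  Unique xs → (∀ {x y} → x ∈ xs → R x y → Q y) → (∀ {x x′ y} → x ∈ xs → x′ ∈ xs → R x y → R x′ y → x ≡ x′) →
  (∀ {x} → x ∈ xs → m ≤ length (filter (R? x) ys)) → length xs * m ≤ length (filter Q? ys)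
disjointFibres R? Q? m [] ys _ _ _ _ = z≤n
disjointFibres {R = R} R? Q? m (x ∷ xs) ys (x∉xs ∷ unique) R⇒Q inj many = begin
  -- The fibre of `x` is removed from `Q`; the other fibres remain inside by disjointness.
  m + length xs * m ≤⟨ +-mono-≤ (many (here refl)) (disjointFibres R? (λ y → Q? y ×-dec ¬? (R? x y)) m xs ys unique
      (λ x′∈ r → R⇒Q (there x′∈) r , λ r′ → All.lookup x∉xs x′∈ (inj (here refl) (there x′∈) r′ r))
      (λ x∈ x′∈ → inj (there x∈) (there x′∈)) (λ x∈ → many (there x∈))) ⟩
  length (filter (R? x) ys) + length (filter (λ y → Q? y ×-dec ¬? (R? x y)) ys) ≡⟨ filter-split (R? x) Q? (R⇒Q (here refl)) ys ⟩
  length (filter Q? ys) ∎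
  where open ≤-Reasoning

module Coloured {r n} (χ : Vec (Fin r) n) where
  open import Data.List.Membership.DecPropositional (Fin._≟_ {r}) using () renaming (_∈?_ to _∈ᶜ?_)

  colour : Fin n → Fin r
  colour = lookup χ

  -- Among rainbow edges, agreeing off `cs` means sharing the vertices of all colours outside `cs`.
  -- Thus `codegree a H e` is the codegree in `H` of the set left when `e` loses its vertex of
  -- colour `a`.
  AgreeOff : List (Fin r) → Subset n → Subset n → Set
  AgreeOff cs e e′ = ∀ v → colour v ∉ cs → lookup e v ≡ lookup e′ v

  agreeOff? : ∀ cs e e′ → Dec (AgreeOff cs e e′)
  agreeOff? cs e e′ = Finₚ.all? λ v → ¬? (colour v ∈ᶜ? cs) →-dec (lookup e v Boolₚ.≟ lookup e′ v)

  countAgreeing : List (Fin r) → EdgeList n → Subset n → ℕ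
  countAgreeing cs H e = length (filter (agreeOff? cs e) H)

  codegree : Fin r → EdgeList n → Subset n → ℕ
  codegree a = countAgreeing (a ∷ [])

  countAgreeing-mono : ∀ cs {G H} → G ⊆ H → ∀ e → countAgreeing cs G e ≤ countAgreeing cs H e
  countAgreeing-mono cs G⊆H e = length-mono-≤ (filter⁺ (agreeOff? cs e) (agreeOff? cs e) (λ { refl → id }) G⊆H)

  -- An edge e′ of `K` that differs from `e` only in colour `a` can be recovered from any edge
  -- agreeing with e′ off `cs`: the latter fixes colour `a`, as `a ∉ cs`, and `e` fixes the rest. So
  -- different e′ contribute disjoint sets of edges.
  codegree-extends : ∀ {a cs} → a ∉ cs → ∀ {K} H → Unique K → ∀ m → (∀ {e} → e ∈ K → m ≤ countAgreeing cs H e) →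
    ∀ e → codegree a K e * m ≤ countAgreeing (a ∷ cs) H e
  codegree-extends {a} {cs} a∉cs {K} H unique m many e =
    disjointFibres (agreeOff? cs) (agreeOff? (a ∷ cs) e) m (filter (agreeOff? (a ∷ []) e) K) H
      (Uniqueₚ.filter⁺ (agreeOff? (a ∷ []) e) unique) (λ {e′} {f} → extends {e′} {f}) (λ {e′} {e″} {f} → injective {e′} {e″} {f}) (λ e′∈ → many (proj₁ (near e′∈)))
    where
    near : ∀ {e′} → e′ ∈ filter (agreeOff? (a ∷ []) e) K → e′ ∈ K × AgreeOff (a ∷ []) e e′
    near = ∈-filter⁻ (agreeOff? (a ∷ []) e) {xs = K}
    extends : ∀ {e′ f} → e′ ∈ filter (agreeOff? (a ∷ []) e) K → AgreeOff cs e′ f → AgreeOff (a ∷ cs) e f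
    extends e′∈ agree v v∉ = trans (proj₂ (near e′∈) v λ { (here eq) → v∉ (here eq) }) (agree v (v∉ ∘ there))
    injective : ∀ {e′ e″ f} → e′ ∈ filter (agreeOff? (a ∷ []) e) K → e″ ∈ filter (agreeOff? (a ∷ []) e) K →
      AgreeOff cs e′ f → AgreeOff cs e″ f → e′ ≡ e″
    injective {e′} {e″} e′∈ e″∈ agree′ agree″ = lookup-extensional pointwise
      where
      pointwise : ∀ v → lookup e′ v ≡ lookup e″ v
      pointwise v with colour v Fin.≟ a
      ... | yes refl = trans (agree′ v a∉cs) (sym (agree″ v a∉cs))
      ... | no ≢a = trans (sym (proj₂ (near e′∈) v λ { (here eq) → ≢a eq })) (proj₂ (near e″∈) v λ { (here eq) → ≢a eq })

  -- Edges of codegree at most T in the colour at hand are split off one colour at a time; the edges surviving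
  -- the colours cs have at least (T + 1) ^ |cs| edges agreeing with them off cs, so none survives all colours but c.
  peel : ∀ {H} c T Δ → (∀ cs → c ∉ cs → ∀ {e} → e ∈ H → countAgreeing cs H e ≤ Δ) → ∃ (_≢ c) →
    ∀ as cs → Unique as → All (_≢ c) as → (∀ {a} → a ∈ as → a ∉ cs) → c ∉ cs →
    Δ < suc T ^ (length as + length cs) →
    ∀ K → K ⊆ H → Unique K → (∀ {e} → e ∈ K → suc T ^ length cs ≤ countAgreeing cs H e) →
    ∃ λ a → a ≢ c × ∃ λ G → G ⊆ K × (∀ {e} → e ∈ G → codegree a G e ≤ T) × length K ≤ length as * length G
  -- No edges are left, and any colour other than `c` will do.
  peel c T Δ bounded (d , d≢c) [] cs _ _ _ c∉cs Δ< [] _ _ _ = d , d≢c , [] , [] , (λ ()) , z≤n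
  peel c T Δ bounded _ [] cs _ _ _ c∉cs Δ< (e ∷ K) K⊆H _ many =
    ⊥-elim (<⇒≱ Δ< (≤-trans (many (here refl)) (bounded cs c∉cs (Sub.lookup K⊆H (here refl)))))
  peel {H} c T Δ bounded default (a ∷ as) cs (a∉as ∷ unique) (a≢c ∷ ≢c) fresh c∉cs Δ< K K⊆H K! many =
    larger (peel c T Δ bounded default as (a ∷ cs) unique ≢c fresh′ c∉
      (subst (λ k → Δ < suc T ^ k) (sym (+-suc (length as) (length cs))) Δ<)
      high (⊆-trans (filter-⊆ high? K) K⊆H) (Uniqueₚ.filter⁺ high? K!) many′)
    where
    open ≤-Reasoning
    high? = λ e → suc T ≤? codegree a K e
    high = filter high? K
    low = filter (¬? ∘ high?) K
    fresh′ : ∀ {b} → b ∈ as → b ∉ a ∷ cs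
    fresh′ b∈ (here refl) = All.lookup a∉as b∈ refl
    fresh′ b∈ (there b∈cs) = fresh (there b∈) b∈cs
    c∉ : c ∉ a ∷ cs
    c∉ (here c≡a) = a≢c (sym c≡a)
    c∉ (there c∈) = c∉cs c∈
    many′ : ∀ {e} → e ∈ high → suc T ^ suc (length cs) ≤ countAgreeing (a ∷ cs) H e
    many′ {e} e∈ with ∈-filter⁻ high? {xs = K} e∈
    ... | _ , T< = ≤-trans (*-monoˡ-≤ (suc T ^ length cs) T<) (codegree-extends (fresh (here refl)) H K! (suc T ^ length cs) many e)
    lowCodegree : ∀ {e} → e ∈ low → codegree a low e ≤ T
    lowCodegree {e} e∈ = ≤-trans (countAgreeing-mono (a ∷ []) (filter-⊆ (¬? ∘ high?) K) e)
      (≤-pred (≰⇒> (proj₂ (∈-filter⁻ (¬? ∘ high?) {xs = K} e∈))))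
    larger : (∃ λ a′ → a′ ≢ c × ∃ λ G → G ⊆ high × (∀ {e} → e ∈ G → codegree a′ G e ≤ T) × length high ≤ length as * length G) →
      ∃ λ a′ → a′ ≢ c × ∃ λ G → G ⊆ K × (∀ {e} → e ∈ G → codegree a′ G e ≤ T) × length K ≤ suc (length as) * length G
    -- Each colour sets aside one candidate subgraph. Keeping the largest of them loses a factor
    -- equal to the number of colours.
    larger (a′ , a′≢c , G , G⊆ , codeg≤ , large) with ≤-total (length G) (length low)
    ... | inj₁ G≤ = a , a≢c , low , filter-⊆ (¬? ∘ high?) K , lowCodegree , (begin
      length K ≡⟨ sym (filter-complement high? K) ⟩
      length low + length high ≤⟨ +-monoʳ-≤ (length low) (≤-trans large (*-monoʳ-≤ (length as) G≤)) ⟩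
      suc (length as) * length low ∎)
    ... | inj₂ G≥ = a′ , a′≢c , G , ⊆-trans G⊆ (filter-⊆ high? K) , codeg≤ , (begin
      length K ≡⟨ sym (filter-complement high? K) ⟩
      length low + length high ≤⟨ +-mono-≤ G≥ large ⟩
      suc (length as) * length G ∎)

lowCodegreeColour : ∀ {r n} (χ : Vec (Fin (suc (suc r))) n) → let open Coloured χ in ∀ {H} c T Δ → Δ < suc T ^ suc r →
  (∀ cs → c ∉ cs → ∀ {e} → e ∈ H → countAgreeing cs H e ≤ Δ) → Unique H →
  ∃ λ a → a ≢ c × ∃ λ G → G ⊆ H × (∀ {e} → e ∈ G → codegree a G e ≤ T) × length H ≤ suc r * length G
lowCodegreeColour {r} χ {H} c T Δ Δ< bounded H! =
  subst (λ k → ∃ λ a → a ≢ c × ∃ λ G → G ⊆ H × (∀ {e} → e ∈ G → codegree a G e ≤ T) × length H ≤ k * length G)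
    count (peel c T Δ bounded (punchIn c zero , Finₚ.punchInᵢ≢i c zero) others [] others! (All.tabulate ≢c) (λ _ ()) (λ ())
      (subst (λ k → Δ < suc T ^ k) (sym (trans (+-identityʳ (length others)) count)) Δ<) H ⊆-refl H!
      λ {e} e∈ → filter-some (agreeOff? [] e) (lose e∈ λ _ _ → refl))
  where
  open Coloured χ
  others = map (punchIn c) (allFin (suc r))
  count : length others ≡ suc r
  count = trans (length-map (punchIn c) (allFin (suc r))) (length-tabulate id)
  others! : Unique others
  others! = Uniqueₚ.map⁺ (Finₚ.punchIn-injective c _ _) (Uniqueₚ.allFin⁺ (suc r))
  ≢c : ∀ {a} → a ∈ others → a ≢ c
  ≢c a∈ refl with ∈-map⁻ (punchIn c) a∈
  ... | b , _ , eq = Finₚ.punchInᵢ≢i c b (sym eq)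

deg≤maxDeg : ∀ {n} (H : EdgeList n) v → deg H v ≤ maxDeg H
deg≤maxDeg {n} H v = go (allFin n) (∈-allFin v)
  where
  go : ∀ vs → v ∈ vs → deg H v ≤ foldr _⊔_ 0 (map (deg H) vs)
  go (w ∷ vs) (here refl) = m≤m⊔n (deg H v) _
  go (w ∷ vs) (there v∈) = ≤-trans (go vs v∈) (m≤n⊔m (deg H w) _)

filter-length-mono : ∀ {A : Set} {P Q : A → Set} (P? : ∀ x → Dec (P x)) (Q? : ∀ x → Dec (Q x)) → (∀ {x} → P x → Q x) →
  ∀ {xs ys} → xs ⊆ ys → length (filter P? xs) ≤ length (filter Q? ys)
filter-length-mono P? Q? P⇒Q xs⊆ys = length-mono-≤ (filter⁺ P? Q? (λ { refl → P⇒Q }) xs⊆ys)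

module _ {r n} {χ : Vec (Fin r) n} where
  open Coloured χ
  open Rainbow

  -- All edges counted contain the vertex of colour `c` of `e`, because `c ∉ cs`.
  countAgreeing≤maxDeg : ∀ {c cs} {H₀ H : EdgeList n} → c ∉ cs → H ⊆ H₀ → ∀ {e} → Rainbow χ e → countAgreeing cs H e ≤ maxDeg H₀
  countAgreeing≤maxDeg {c} {cs} {H₀} c∉cs H⊆H₀ {e} rainbow with has rainbow c
  ... | v , v∈e , refl = ≤-trans (filter-length-mono (agreeOff? cs e) (v ∈?_) contains H⊆H₀) (deg≤maxDeg H₀ v)
    where
    contains : ∀ {e′} → AgreeOff cs e e′ → v ∈ₛ e′
    contains {e′} agree = Vecₚ.lookup⇒[]= v e′ (trans (sym (agree v c∉cs)) (Vecₚ.[]=⇒lookup v∈e))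

  agree⇒≡ : ∀ {a e e′ v} → Rainbow χ e → Rainbow χ e′ → AgreeOff (a ∷ []) e e′ →
    v ∈ₛ e → v ∈ₛ e′ → colour v ≡ a → e ≡ e′
  agree⇒≡ {a} {e} {e′} {v} R R′ agree v∈e v∈e′ v≡a = lookup-extensional pointwise
    where
    pointwise : ∀ w → lookup e w ≡ lookup e′ w
    pointwise w with colour w Fin.≟ a
    ... | no w≢a = agree w λ { (here eq) → w≢a eq }
    ... | yes w≡a with lookup e w in eq | lookup e′ w in eq′
    ...   | inside | inside = refl
    ...   | outside | outside = refl
    ...   | inside | outside = trans (sym (trans (cong (lookup e′) (unique R (Vecₚ.lookup⇒[]= w e eq) v∈e (trans w≡a (sym v≡a)))) (Vecₚ.[]=⇒lookup v∈e′))) eq′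
    ...   | outside | inside = trans (sym eq) (trans (cong (lookup e) (unique R′ (Vecₚ.lookup⇒[]= w e′ eq′) v∈e′ (trans w≡a (sym v≡a)))) (Vecₚ.[]=⇒lookup v∈e))

-- The vertex of colour c in e; the junk value zero is never used on rainbow edges.
vertex : ∀ {r n} → Vec (Fin r) (suc n) → Fin r → Subset (suc n) → Fin (suc n)
vertex χ c e with Finₚ.any? (λ v → (v ∈? e) ×-dec (lookup χ v Fin.≟ c))
... | yes (v , _) = v
... | no _ = zero

module _ {r n} {χ : Vec (Fin r) (suc n)} where
  open Coloured χ
  open Rainbow

  vertex-unique : ∀ {e c v} → Rainbow χ e → v ∈ₛ e → colour v ≡ c → vertex χ c e ≡ v
  vertex-unique {e} {c} {v} R v∈ v≡c with Finₚ.any? (λ v → (v ∈? e) ×-dec (lookup χ v Fin.≟ c))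
  ... | yes (w , w∈ , w≡c) = unique R w∈ v∈ (trans w≡c (sym v≡c))
  ... | no none = ⊥-elim (none (v , v∈ , v≡c))

  vertex-distinct : ∀ {a e e′} → Rainbow χ e → Rainbow χ e′ → AgreeOff (a ∷ []) e e′ → e ≢ e′ → vertex χ a e ≢ vertex χ a e′
  vertex-distinct {a} R R′ agree e≢e′ eq with has R a | has R′ a
  ... | v , v∈ , v≡a | v′ , v′∈ , v′≡a = e≢e′ (agree⇒≡ R R′ agree v∈
    (subst (_∈ₛ _) (trans (sym (vertex-unique R′ v′∈ v′≡a)) (trans (sym eq) (vertex-unique R v∈ v≡a))) v′∈) v≡a)

  Conflict : Fin r → Subset (suc n) → Subset (suc n) → Set
  Conflict a e e′ = AgreeOff (a ∷ []) e e′ × e ≢ e′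

  conflict? : ∀ a e e′ → Dec (Conflict a e e′)
  conflict? a e e′ = agreeOff? (a ∷ []) e e′ ×-dec ¬? (Vecₚ.≡-dec Boolₚ._≟_ e e′)

  conflictPairs : EdgeList (suc n) → Fin r → Subset (suc n) → List (Fin (suc n) × Fin (suc n))
  conflictPairs G a e = map (λ e′ → vertex χ a e , vertex χ a e′) (filter (conflict? a e) G)

  -- An edge has at most T conflicts in each of the two colours, hence at most 2T, and `separate`
  -- asks for twice as many values: this is the 4 in `4 * T ≤ N`.
  separateEdges : ∀ {N} .{{_ : NonZero N}} G a b T .{{_ : NonZero T}} → 4 * T ≤ N → All (Rainbow χ) G →
    (∀ {e} → e ∈ G → codegree a G e ≤ T) → (∀ {e} → e ∈ G → codegree b G e ≤ T) →
    ∃ λ (h : Vec (Fin N) (suc n)) → ∃ λ G′ → G′ ⊆ G × length G ≤ 2 * length G′ ×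
      (∀ {e e′} → e ∈ G′ → e′ ∈ G′ → ∀ c → c ≡ a ⊎ c ≡ b → AgreeOff (c ∷ []) e e′ → e ≢ e′ →
        lookup h (vertex χ c e) ≢ lookup h (vertex χ c e′))
  separateEdges {N} G a b T 4T≤N rainbow codegᵃ codegᵇ =
    h , filter good? G , filter-⊆ good? G , proj₂ separation , separated
    where
    conflicts = λ e → conflictPairs G a e ++ conflictPairs G b e
    few : ∀ {c e} → codegree c G e ≤ T → length (conflictPairs G c e) ≤ T
    few {c} {e} codeg≤ = subst (_≤ T) (sym (length-map _ (filter (conflict? c e) G)))
      (≤-trans (filter-length-mono (conflict? c e) (agreeOff? (c ∷ []) e) proj₁ {G} {G} ⊆-refl) codeg≤)
    distinct : ∀ {c e} → e ∈ G → All (λ (v , w) → v ≢ w) (conflictPairs G c e)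
    distinct {c} {e} e∈ = Allₚ.map⁺ (All.tabulate λ {e′} e′∈ → let e′∈G , agree , ≢ = ∈-filter⁻ (conflict? c e) {xs = G} e′∈ in
      vertex-distinct (All.lookup rainbow e∈) (All.lookup rainbow e′∈G) agree ≢)
    valid : ∀ e → e ∈ G → length (conflicts e) ≤ 2 * T × All (λ (v , w) → v ≢ w) (conflicts e)
    valid e e∈ = subst₂ _≤_ (sym (length-++ (conflictPairs G a e))) (cong (T +_) (sym (+-identityʳ T)))
        (+-mono-≤ (few (codegᵃ e∈)) (few (codegᵇ e∈)))
      , Allₚ.++⁺ (distinct e∈) (distinct e∈)
    separation = separate conflicts G (2 * T) {{m*n≢0 2 T}} (subst (_≤ N) (*-assoc 2 2 T) 4T≤N) valid
    h = proj₁ separation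
    good? = λ e → separates? h (conflicts e)
    separated : ∀ {e e′} → e ∈ filter good? G → e′ ∈ filter good? G → ∀ c → c ≡ a ⊎ c ≡ b → AgreeOff (c ∷ []) e e′ → e ≢ e′ →
        lookup h (vertex χ c e) ≢ lookup h (vertex χ c e′)
    separated {e} {e′} e∈ e′∈ c c≡ agree e≢e′ =
      All.lookup (pick c≡) (∈-map⁺ _ (∈-filter⁺ (conflict? c e) (proj₁ (∈-filter⁻ good? {xs = G} e′∈)) (agree , e≢e′)))
      where
      sep = proj₂ (∈-filter⁻ good? {xs = G} e∈)
      pick : c ≡ a ⊎ c ≡ b → Separates h (conflictPairs G c e)
      pick (inj₁ refl) = Allₚ.++⁻ˡ (conflictPairs G a e) sep
      pick (inj₂ refl) = Allₚ.++⁻ʳ (conflictPairs G a e) sep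

-- Tight cycles

∈-⋃⁺ : ∀ {n} (g : ℕ → Subset n) {v} js {j} → j ∈ js → v ∈ₛ g j → v ∈ₛ foldr _∪_ ∅ (map g js)
∈-⋃⁺ g (j ∷ js) (here refl) v∈ = x∈p∪q⁺ (inj₁ v∈)
∈-⋃⁺ g (_ ∷ js) (there j∈) v∈ = x∈p∪q⁺ (inj₂ (∈-⋃⁺ g js j∈ v∈))

∈-⋃⁻ : ∀ {n} (g : ℕ → Subset n) {v} js → v ∈ₛ foldr _∪_ ∅ (map g js) → ∃ λ j → j ∈ js × v ∈ₛ g j
∈-⋃⁻ g [] v∈ = ⊥-elim (∉⊥ v∈)
∈-⋃⁻ g (j ∷ js) v∈ with x∈p∪q⁻ (g j) _ v∈
... | inj₁ v∈g = j , here refl , v∈g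
... | inj₂ v∈⋃ with ∈-⋃⁻ g js v∈⋃
...   | i , i∈ , v∈g = i , there i∈ , v∈g

%-shift⇒∣ : ∀ k .{{_ : NonZero k}} t j → (t + j) % k ≡ t % k → k ∣ j
%-shift⇒∣ k t j eq = ∣m+n∣m⇒∣n (divides ((t + j) / k) multiple) (n∣m*n (t / k))
  where
  multiple : t / k * k + j ≡ (t + j) / k * k
  multiple = +-cancelˡ-≡ (t % k) _ _ (begin
    t % k + (t / k * k + j) ≡⟨ sym (+-assoc (t % k) (t / k * k) j) ⟩
    t % k + t / k * k + j ≡⟨ cong (_+ j) (sym (m≡m%n+[m/n]*n t k)) ⟩
    t + j ≡⟨ m≡m%n+[m/n]*n (t + j) k ⟩
    (t + j) % k + (t + j) / k * k ≡⟨ cong (_+ (t + j) / k * k) eq ⟩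
    t % k + (t + j) / k * k ∎)
    where open ≡-Reasoning

-- The cycle unrolled to a periodic sequence of vertices `u` and windows `W`, so that later
-- arguments shift positions without reducing them modulo k.
record TightWalk {r n} (χ : Vec (Fin (suc r)) n) (G : EdgeList n) (k : ℕ) : Set where
  open Coloured χ
  field
    u                    : ℕ → Fin n
    W                    : ℕ → Subset n
    W∈G                  : ∀ t → W t ∈ G
    u+j∈W                : ∀ t j → j < suc r → u (t + j) ∈ₛ W t
    u-period             : ∀ t → u (t + k) ≡ u t
    colour-period        : ∀ t → colour (u (t + suc r)) ≡ colour (u t)
    consecutive-agree    : ∀ t → AgreeOff (colour (u t) ∷ []) (W t) (W (suc t))
    consecutive-distinct : ∀ t → W t ≢ W (suc t)
    colour-offset        : ∀ t c → ∃ λ s → s < suc r × colour (u (t + s)) ≡ c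
    r∣k                  : suc r ∣ k

  u∈W : ∀ t → u t ∈ₛ W t
  u∈W t = subst (λ s → u s ∈ₛ W t) (+-identityʳ t) (u+j∈W t 0 (s≤s z≤n))

  u+r∈W : ∀ t → u (t + suc r) ∈ₛ W (suc t)
  u+r∈W t = subst (λ s → u s ∈ₛ W (suc t)) (sym (+-suc t r)) (u+j∈W (suc t) r ≤-refl)

  colour-periods : ∀ t c → colour (u (t + c * suc r)) ≡ colour (u t)
  colour-periods t zero = cong (λ s → colour (u s)) (+-identityʳ t)
  colour-periods t (suc c) = begin
    colour (u (t + (suc r + c * suc r))) ≡⟨ cong (λ s → colour (u s)) (trans (cong (t +_) (+-comm (suc r) (c * suc r))) (sym (+-assoc t (c * suc r) (suc r)))) ⟩
    colour (u (t + c * suc r + suc r)) ≡⟨ colour-period (t + c * suc r) ⟩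
    colour (u (t + c * suc r)) ≡⟨ colour-periods t c ⟩
    colour (u t) ∎
    where open ≡-Reasoning

module TightCycle {r′ m n} (χ : Vec (Fin (suc r′)) n) (f : Fin (suc m) → Fin n) (f-injective : Injective _≡_ _≡_ f)
  (r≤m : suc r′ ≤ m) (rainbow : ∀ i → Rainbow χ (window (suc r′) f i)) where

  open Coloured χ
  open Rainbow

  r k : ℕ
  r = suc r′
  k = suc m

  position : ℕ → Fin k
  position t = fromℕ< (m%n<n t k)

  u : ℕ → Fin n
  u t = f (position t)

  W : ℕ → Subset n
  W t = window r f (position t)

  position-cong : ∀ s t → s % k ≡ t % k → position s ≡ position t
  position-cong s t eq = Finₚ.fromℕ<-cong (s % k) (t % k) eq (m%n<n s k) (m%n<n t k)

  u-injective : ∀ t j → u (t + j) ≡ u t → k ∣ j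
  u-injective t j eq = %-shift⇒∣ k t j
    (Finₚ.fromℕ<-injective ((t + j) % k) (t % k) (m%n<n (t + j) k) (m%n<n t k) (f-injective eq))

  distinct : ∀ t j → 1 ≤ j → j < k → u (t + j) ≢ u t
  distinct t (suc j) _ j<k eq = <⇒≱ j<k (∣⇒≤ (u-injective t (suc j) eq))

  u-period : ∀ t c → u (t + c * k) ≡ u t
  u-period t c = cong f (position-cong (t + c * k) t ([m+kn]%n≡m%n t c k))

  cycIdx-position : ∀ t j → cycIdx m (position t) j ≡ position (t + j)
  cycIdx-position t j = Finₚ.fromℕ<-cong _ _ (begin
    (toℕ (position t) + j) % k ≡⟨ cong (λ x → (x + j) % k) (Finₚ.toℕ-fromℕ< (m%n<n t k)) ⟩
    (t % k + j) % k ≡⟨ %-distribˡ-+ (t % k) j k ⟩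
    (t % k % k + j % k) % k ≡⟨ cong (λ x → (x + j % k) % k) (m%n%n≡m%n t k) ⟩
    (t % k + j % k) % k ≡⟨ sym (%-distribˡ-+ t j k) ⟩
    (t + j) % k ∎) _ _
    where open ≡-Reasoning

  ∈W⁺ : ∀ t j → j < r → u (t + j) ∈ₛ W t
  ∈W⁺ t j j<r = ∈-⋃⁺ (λ j → ⁅ f (cycIdx m (position t) j) ⁆) (upTo r) (∈-upTo⁺ j<r)
    (subst (λ i → u (t + j) ∈ₛ ⁅ f i ⁆) (sym (cycIdx-position t j)) (x∈⁅x⁆ (u (t + j))))

  ∈W⁻ : ∀ t {v} → v ∈ₛ W t → ∃ λ j → j < r × v ≡ u (t + j)
  ∈W⁻ t v∈ with ∈-⋃⁻ (λ j → ⁅ f (cycIdx m (position t) j) ⁆) (upTo r) v∈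
  ... | j , j∈ , v∈j = j , ∈-upTo⁻ j∈ , trans (x∈⁅y⁆⇒x≡y _ v∈j) (cong f (cycIdx-position t j))

  u∈W : ∀ t → u t ∈ₛ W t
  u∈W t = subst (λ s → u s ∈ₛ W t) (+-identityʳ t) (∈W⁺ t 0 (s≤s z≤n))

  rainbowW : ∀ t → Rainbow χ (W t)
  rainbowW t = rainbow (position t)

  -- W (t + 1) contains a vertex coloured like u t, which cannot lie in W t.
  colour-period : ∀ t → colour (u (t + r)) ≡ colour (u t)
  colour-period t with has (rainbowW (suc t)) (colour (u t))
  ... | v , v∈ , same with ∈W⁻ (suc t) v∈
  ...   | j , j<r , refl with j ≟ r′
  ...     | yes refl = trans (cong (λ s → colour (u s)) (+-suc t r′)) same
  ...     | no j≢r′ = ⊥-elim (distinct t (suc j) (s≤s z≤n) (≤-trans (s≤s j<r) (s≤s r≤m))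
            (trans (cong u (+-suc t j)) (unique (rainbowW t) inW (u∈W t) same)))
    where
    inW : u (suc t + j) ∈ₛ W t
    inW = subst (λ s → u s ∈ₛ W t) (+-suc t j) (∈W⁺ t (suc j) (s≤s (≤∧≢⇒< (≤-pred j<r) j≢r′)))

  colour-periods : ∀ t c → colour (u (t + c * r)) ≡ colour (u t)
  colour-periods t zero = cong (colour ∘ u) (+-identityʳ t)
  colour-periods t (suc c) = begin
    colour (u (t + (r + c * r))) ≡⟨ cong (colour ∘ u) (trans (cong (t +_) (+-comm r (c * r))) (sym (+-assoc t (c * r) r))) ⟩
    colour (u (t + c * r + r)) ≡⟨ colour-period (t + c * r) ⟩
    colour (u (t + c * r)) ≡⟨ colour-periods t c ⟩
    colour (u t) ∎
    where open ≡-Reasoning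

  -- Going around the cycle shows that `u (k % r)` has the colour of `u 0`. Both lie in the rainbow
  -- edge `W 0`, so they coincide, which forces the remainder to be 0.
  r∣k : r ∣ k
  r∣k with k % r ≟ 0
  ... | yes k%r≡0 = m%n≡0⇒n∣m k r k%r≡0
  ... | no k%r≢0 = ⊥-elim (distinct 0 (k % r) (n≢0⇒n>0 k%r≢0) (<-≤-trans (m%n<n k r) (≤-trans r≤m (n≤1+n m)))
    (unique (rainbowW 0) (∈W⁺ 0 (k % r) (m%n<n k r)) (u∈W 0) (begin
      colour (u (k % r)) ≡⟨ sym (colour-periods (k % r) (k / r)) ⟩
      colour (u (k % r + k / r * r)) ≡⟨ cong (colour ∘ u) (sym (m≡m%n+[m/n]*n k r)) ⟩
      colour (u k) ≡⟨ cong (colour ∘ u) (sym (*-identityˡ k)) ⟩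
      colour (u (1 * k)) ≡⟨ cong colour (u-period 0 1) ⟩
      colour (u 0) ∎)))
    where open ≡-Reasoning

  -- Passing to the next window replaces `u t` by `u (t + r)`, which has the same colour by
  -- `colour-period`.
  consecutive-agree : ∀ t → AgreeOff (colour (u t) ∷ []) (W t) (W (suc t))
  consecutive-agree t v v≢ with lookup (W t) v in eq | lookup (W (suc t)) v in eq′
  ... | inside | inside = refl
  ... | outside | outside = refl
  ... | inside | outside with ∈W⁻ t (Vecₚ.lookup⇒[]= v (W t) eq)
  ...   | zero , _ , refl = ⊥-elim (v≢ (here (cong (colour ∘ u) (+-identityʳ t))))
  ...   | suc j , j<r , refl = trans (sym (Vecₚ.[]=⇒lookup
          (subst (λ s → u s ∈ₛ W (suc t)) (sym (+-suc t j)) (∈W⁺ (suc t) j (<-trans (n<1+n j) j<r))))) eq′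
  consecutive-agree t v v≢ | outside | inside with ∈W⁻ (suc t) (Vecₚ.lookup⇒[]= v (W (suc t)) eq′)
  ... | j , j<r , refl with j ≟ r′
  ...   | yes refl = ⊥-elim (v≢ (here (trans (cong (colour ∘ u) (sym (+-suc t r′))) (colour-period t))))
  ...   | no j≢r′ = trans (sym eq) (Vecₚ.[]=⇒lookup
          (subst (λ s → u s ∈ₛ W t) (+-suc t j) (∈W⁺ t (suc j) (s≤s (≤∧≢⇒< (≤-pred j<r) j≢r′)))))

  consecutive-distinct : ∀ t → W t ≢ W (suc t)
  consecutive-distinct t eq with ∈W⁻ (suc t) (subst (u t ∈ₛ_) eq (u∈W t))
  ... | j , j<r , same = distinct t (suc j) (s≤s z≤n) (≤-trans (s≤s j<r) (s≤s r≤m)) (trans (cong u (+-suc t j)) (sym same))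

  colour-offset : ∀ t c → ∃ λ s → s < r × colour (u (t + s)) ≡ c
  colour-offset t c with has (rainbowW t) c
  ... | v , v∈ , eq with ∈W⁻ t v∈
  ...   | s , s<r , refl = s , s<r , eq

tightWalk : ∀ {r m n} (χ : Vec (Fin (suc r)) n) (G : EdgeList n) → (∀ {e} → e ∈ G → Rainbow χ e) →
  suc r ≤ m → ContainsTC (suc r) m G → TightWalk χ G (suc m)
tightWalk χ G rainbow r≤m (f , f-injective , f∈) = record
  { u = u ; W = W ; W∈G = λ t → f∈ (position t) ; u+j∈W = ∈W⁺
  ; u-period = λ t → trans (cong (λ s → u (t + s)) (sym (*-identityˡ k))) (u-period t 1)
  ; colour-period = colour-period
  ; consecutive-agree = consecutive-agree ; consecutive-distinct = consecutive-distinct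
  ; colour-offset = colour-offset ; r∣k = r∣k }
  where open TightCycle χ f f-injective r≤m (λ i → rainbow (f∈ i))

-- Vertices as points and lines modulo P

residue : ∀ P .{{_ : NonZero P}} → ℤ → Fin P
residue P x = fromℕ< (ℤᵈ.n%ℕd<d x P)

residue≡⇒∣ : ∀ P .{{_ : NonZero P}} x y → residue P x ≡ residue P y → pos P ∣ᶻ (x ℤ.- y)
residue≡⇒∣ P x y eq = ℤˢ.divides (x ℤᵈ./ℕ P ℤ.- y ℤᵈ./ℕ P) (begin
  x ℤ.- y ≡⟨ cong₂ ℤ._-_ (ℤᵈ.a≡a%ℕn+[a/ℕn]*n x P) (ℤᵈ.a≡a%ℕn+[a/ℕn]*n y P) ⟩
  (pos (x ℤᵈ.%ℕ P) ℤ.+ x ℤᵈ./ℕ P ℤ.* pos P) ℤ.- (pos (y ℤᵈ.%ℕ P) ℤ.+ y ℤᵈ./ℕ P ℤ.* pos P)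
    ≡⟨ cong (λ s → (pos s ℤ.+ x ℤᵈ./ℕ P ℤ.* pos P) ℤ.- (pos (y ℤᵈ.%ℕ P) ℤ.+ y ℤᵈ./ℕ P ℤ.* pos P)) same ⟩
  (pos (y ℤᵈ.%ℕ P) ℤ.+ x ℤᵈ./ℕ P ℤ.* pos P) ℤ.- (pos (y ℤᵈ.%ℕ P) ℤ.+ y ℤᵈ./ℕ P ℤ.* pos P)
    ≡⟨ expand (pos (y ℤᵈ.%ℕ P)) (x ℤᵈ./ℕ P) (y ℤᵈ./ℕ P) (pos P) ⟩
  (x ℤᵈ./ℕ P ℤ.- y ℤᵈ./ℕ P) ℤ.* pos P ∎)
  where
  open ≡-Reasoning
  same : x ℤᵈ.%ℕ P ≡ y ℤᵈ.%ℕ P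
  same = trans (sym (Finₚ.toℕ-fromℕ< (ℤᵈ.n%ℕd<d x P))) (trans (cong toℕ eq) (Finₚ.toℕ-fromℕ< (ℤᵈ.n%ℕd<d y P)))
  expand : ∀ s a b p → (s ℤ.+ a ℤ.* p) ℤ.- (s ℤ.+ b ℤ.* p) ≡ (a ℤ.- b) ℤ.* p
  expand = ℤSolver.solve-∀

∣∸⇒≡ : ∀ {P i j} → i ≤ j → j < P → P ∣ (j ∸ i) → i ≡ j
∣∸⇒≡ {P} {i} {j} i≤j j<P P∣ with j ∸ i in eq
... | zero = ≤-antisym i≤j (m∸n≡0⇒m≤n eq)
... | suc x = ⊥-elim (<⇒≱ (≤-<-trans (≤-trans (≤-reflexive (sym eq)) (m∸n≤m j i)) j<P) (∣⇒≤ P∣))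

small-congruent : ∀ {P i j} → i < P → j < P → pos P ∣ᶻ (pos i ℤ.- pos j) → i ≡ j
small-congruent {P} {i} {j} i<P j<P d with ≤-total i j
... | inj₁ i≤j = ∣∸⇒≡ i≤j j<P (subst (P ∣_) (trans (cong ℤ.∣_∣ (ℤₚ.m-n≡m⊖n i j)) (ℤₚ.∣⊖∣-≤ i≤j)) (∣⇒∣ᵤ d))
... | inj₂ j≤i = sym (∣∸⇒≡ j≤i i<P (subst (P ∣_) (trans (cong ℤ.∣_∣ (ℤₚ.m-n≡m⊖n i j))
    (trans (ℤₚ.∣m⊖n∣≡∣n⊖m∣ i j) (ℤₚ.∣⊖∣-≤ j≤i))) (∣⇒∣ᵤ d)))

-- `separate` draws images from a single alphabet `Fin N`. With N = P ^ ℓ, a point or line is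
-- encoded as a number whose digits in base P are its coordinates; 0 is the default beyond the last
-- digit.
coordinate : ∀ P ℓ → Fin (P ^ ℓ) → ℕ → ℤ
coordinate P ℓ x i with i <? ℓ
... | yes i<ℓ = pos (toℕ (finToFun {P} {ℓ} x (fromℕ< i<ℓ)))
... | no _ = pos 0

coordinate-toℕ : ∀ P ℓ x (i : Fin ℓ) → coordinate P ℓ x (toℕ i) ≡ pos (toℕ (finToFun {P} {ℓ} x i))
coordinate-toℕ P ℓ x i with toℕ i <? ℓ
... | yes i<ℓ = cong (λ j → pos (toℕ (finToFun {P} {ℓ} x j))) (Finₚ.fromℕ<-toℕ i i<ℓ)
... | no i≮ℓ = ⊥-elim (i≮ℓ (Finₚ.toℕ<n i))

coordinate-injective : ∀ P ℓ x y → (∀ i → i < ℓ → pos P ∣ᶻ (coordinate P ℓ x i ℤ.- coordinate P ℓ y i)) → x ≡ y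
coordinate-injective P ℓ x y same = begin
  x ≡⟨ sym (Finₚ.funToFin-finToFin {ℓ} {P} x) ⟩
  funToFin (finToFun {P} {ℓ} x) ≡⟨ funToFin-cong (λ i → Finₚ.toℕ-injective (small-congruent (Finₚ.toℕ<n _) (Finₚ.toℕ<n _)
      (subst₂ (λ a b → pos P ∣ᶻ (a ℤ.- b)) (coordinate-toℕ P ℓ x i) (coordinate-toℕ P ℓ y i) (same (toℕ i) (Finₚ.toℕ<n i))))) ⟩
  funToFin (finToFun {P} {ℓ} y) ≡⟨ Finₚ.funToFin-finToFin {ℓ} {P} y ⟩
  y ∎
  where
  open ≡-Reasoning
  funToFin-cong : ∀ {m n} {f g : Fin m → Fin n} → (∀ i → f i ≡ g i) → funToFin f ≡ funToFin g
  funToFin-cong {zero} _ = refl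
  funToFin-cong {suc m} eq = cong₂ Fin.combine (eq zero) (funToFin-cong (eq ∘ suc))

module TCFreeness (ℓ′ : ℕ) (ℓ≡ : suc ℓ′ ≡ 2 ⊎ (suc ℓ′ ≡ 3 ⊎ suc ℓ′ ≡ 5)) (P : ℕ) (prime : Prime P) (2<P : 2 < P)
  {r n : ℕ} (χ : Vec (Fin (suc r)) (suc n)) (a b : Fin (suc r)) (a≢b : a ≢ b)
  (h : Vec (Fin (P ^ suc ℓ′)) (suc n)) where

  open Coloured χ
  open Modulo P prime using (Null; noClosedWalk)

  instance
    P≢0 : NonZero P
    P≢0 = prime⇒nonZero prime

  ℓ : ℕ
  ℓ = suc ℓ′

  coord : Fin (suc n) → ℕ → ℤ
  coord v = coordinate P ℓ (lookup h v)

  edgeDefect : Subset (suc n) → ℕ → ℤ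
  edgeDefect e i = defect (suc i) (coord (vertex χ a e)) (coord (vertex χ b e))

  -- The key names the translate of the polygon in which the edge becomes an incident pair. It has
  -- one entry fewer than a point has coordinates, whence the loss P ^ (ℓ - 1) and not P ^ ℓ.
  key : Subset (suc n) → Vec (Fin P) ℓ′
  key e = tabulate λ i → residue P (edgeDefect e (toℕ i))

  key≡⇒Null : ∀ {e e′} → key e ≡ key e′ → ∀ i → suc i < ℓ → Null (edgeDefect e i ℤ.- edgeDefect e′ i)
  key≡⇒Null {e} {e′} eq i (s≤s i<ℓ′) = residue≡⇒∣ P (edgeDefect e i) (edgeDefect e′ i)
    (subst (λ j → residue P (edgeDefect e j) ≡ residue P (edgeDefect e′ j)) (Finₚ.toℕ-fromℕ< i<ℓ′)
      (trans (sym (Vecₚ.lookup∘tabulate _ (fromℕ< i<ℓ′))) (trans (cong (λ k → lookup k (fromℕ< i<ℓ′)) eq)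
        (Vecₚ.lookup∘tabulate _ (fromℕ< i<ℓ′)))))

  module _ (G : EdgeList (suc n)) (rainbow : ∀ {e} → e ∈ G → Rainbow χ e)
    (separated : ∀ {e e′} → e ∈ G → e′ ∈ G → ∀ c → c ≡ a ⊎ c ≡ b → AgreeOff (c ∷ []) e e′ → e ≢ e′ →
      lookup h (vertex χ c e) ≢ lookup h (vertex χ c e′))
    (sameKey : ∀ {e e′} → e ∈ G → e′ ∈ G → key e ≡ key e′) where

    noTightWalk : ∀ {k} → 1 ≤ k → k ≤ ℓ * suc r → TightWalk χ G k → ⊥
    noTightWalk {k} 1≤k k≤ℓr walk = fromOffsets
      (colour-offset 0 a) (λ s₀ → colour-offset s₀ b) r∣k
      where
      open TightWalk walk
      module _ (s₀ s₁ j : ℕ) (s₁<r : s₁ < suc r) (colour₀ : colour (u s₀) ≡ a) (colour₁ : colour (u (s₀ + s₁)) ≡ b)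
        (k≡jr : k ≡ j * suc r) where
        -- Vertices of colour `a` recur at the positions `xₚ t`, and those of colour `b` follow `s₁`
        -- places later. The window at `xₚ t` joins `X t` to `Y t`, and the window at `yₚ t` joins
        -- `Y t` to `X (suc t)`.
        xₚ yₚ : ℕ → ℕ
        xₚ t = s₀ + t * suc r
        yₚ t = xₚ t + s₁
        X Y : ℕ → ℕ → ℤ
        X t = coord (u (xₚ t))
        Y t = coord (u (yₚ t))
        colourₓ : ∀ t → colour (u (xₚ t)) ≡ a
        colourₓ t = trans (colour-periods s₀ t) colour₀
        swap : ∀ t → s₀ + s₁ + t * suc r ≡ yₚ t
        swap t = shuffle s₀ s₁ (t * suc r)
          where
          shuffle : ∀ x y z → x + y + z ≡ x + z + y
          shuffle = solve-∀
        colourᵧ : ∀ t → colour (u (yₚ t)) ≡ b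
        colourᵧ t = trans (cong (colour ∘ u) (sym (swap t)))
          (trans (colour-periods (s₀ + s₁) t) colour₁)
        0<s₁ : 0 < s₁
        0<s₁ = n≢0⇒n>0 λ s₁≡0 → a≢b (trans (sym (colourₓ 0)) (trans (cong (colour ∘ u) (trans (sym (+-identityʳ (xₚ 0))) (cong (λ z → xₚ 0 + z) (sym s₁≡0)))) (colourᵧ 0)))
        xₚ-suc : ∀ t → xₚ (suc t) ≡ xₚ t + suc r
        xₚ-suc t = shuffle s₀ (suc r) (t * suc r)
          where
          shuffle : ∀ x y z → x + (y + z) ≡ x + z + y
          shuffle = solve-∀
        yₚ-suc : ∀ t → yₚ (suc t) ≡ yₚ t + suc r
        yₚ-suc t = trans (cong (_+ s₁) (xₚ-suc t)) (shuffle (xₚ t) (suc r) s₁)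
          where
          shuffle : ∀ x y z → x + y + z ≡ x + z + y
          shuffle = solve-∀
        defectOf : ∀ p {v w} i → v ∈ₛ W p → colour v ≡ a → w ∈ₛ W p → colour w ≡ b →
          edgeDefect (W p) i ≡ defect (suc i) (coord v) (coord w)
        defectOf p i v∈ v≡a w∈ w≡b = cong₂ (λ v w → defect (suc i) (coord v) (coord w))
          (vertex-unique (rainbow (W∈G p)) v∈ v≡a) (vertex-unique (rainbow (W∈G p)) w∈ w≡b)
        incident : ∀ p {v w} i → suc i < ℓ → v ∈ₛ W p → colour v ≡ a → w ∈ₛ W p → colour w ≡ b →
          Null (defect (suc i) (coord v) (coord w) ℤ.- edgeDefect (W (xₚ 0)) i)
        incident p i i<ℓ v∈ v≡a w∈ w≡b = subst (λ z → Null (z ℤ.- edgeDefect (W (xₚ 0)) i)) (defectOf p i v∈ v≡a w∈ w≡b)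
          (key≡⇒Null {W p} {W (xₚ 0)} (sameKey {W p} {W (xₚ 0)} (W∈G p) (W∈G (xₚ 0))) i i<ℓ)
        on : ∀ t i → suc i < ℓ → Null (defect (suc i) (X t) (Y t) ℤ.- edgeDefect (W (xₚ 0)) i)
        on t i i<ℓ = incident (xₚ t) i i<ℓ (u∈W (xₚ t)) (colourₓ t) (u+j∈W (xₚ t) s₁ s₁<r) (colourᵧ t)
        on′ : ∀ t i → suc i < ℓ → Null (defect (suc i) (X (suc t)) (Y t) ℤ.- edgeDefect (W (xₚ 0)) i)
        on′ t i i<ℓ = incident (yₚ t) i i<ℓ
          (subst (λ p → u p ∈ₛ W (yₚ t)) next (u+j∈W (yₚ t) (suc r ∸ s₁) (∸-monoʳ-< 0<s₁ (<⇒≤ s₁<r)))) (colourₓ (suc t))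
          (u∈W (yₚ t)) (colourᵧ t)
          where
          next : yₚ t + (suc r ∸ s₁) ≡ xₚ (suc t)
          next = trans (+-assoc (xₚ t) s₁ (suc r ∸ s₁)) (trans (cong (λ z → xₚ t + z) (m+[n∸m]≡n (<⇒≤ s₁<r))) (sym (xₚ-suc t)))
        -- The windows at `p` and `suc p` differ only in their vertices of colour `c`, namely `u p`
        -- and `u (p + suc r)`. They form a conflict, so `h` separates these vertices.
        moves : ∀ c → c ≡ a ⊎ c ≡ b → ∀ p p′ → p′ ≡ p + suc r → colour (u p) ≡ c →
          ¬ (∀ i → i < ℓ → Null (coord (u p) i ℤ.- coord (u p′) i))
        moves c c≡ p _ refl refl same = separated (W∈G p) (W∈G (suc p)) (colour (u p)) c≡ (consecutive-agree p) (consecutive-distinct p)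
          (begin
            lookup h (vertex χ (colour (u p)) (W p)) ≡⟨ cong (lookup h) (vertex-unique (rainbow (W∈G p)) (u∈W p) refl) ⟩
            lookup h (u p) ≡⟨ coordinate-injective P ℓ (lookup h (u p)) (lookup h (u (p + suc r))) same ⟩
            lookup h (u (p + suc r)) ≡⟨ cong (lookup h) (sym (vertex-unique (rainbow (W∈G (suc p))) (u+r∈W p) (colour-period p))) ⟩
            lookup h (vertex χ (colour (u p)) (W (suc p))) ∎)
          where open ≡-Reasoning
        movesX : ∀ t → ¬ (∀ i → i < ℓ → Null (X t i ℤ.- X (suc t) i))
        movesX t = moves a (inj₁ refl) (xₚ t) (xₚ (suc t)) (xₚ-suc t) (colourₓ t)
        movesY : ∀ t → ¬ (∀ i → i < ℓ → Null (Y t i ℤ.- Y (suc t) i))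
        movesY t = moves b (inj₂ refl) (yₚ t) (yₚ (suc t)) (yₚ-suc t) (colourᵧ t)
        1≤j : 1 ≤ j
        1≤j = n≢0⇒n>0 λ j≡0 → <-irrefl (sym (trans k≡jr (cong (_* suc r) j≡0))) 1≤k
        j≤ℓ : j ≤ ℓ
        j≤ℓ = *-cancelʳ-≤ j ℓ (suc r) (subst (_≤ ℓ * suc r) k≡jr k≤ℓr)
        xₚ-period : ∀ t → xₚ (j + t) ≡ xₚ t + k
        xₚ-period t = trans (shuffle s₀ j t (suc r)) (cong (λ z → xₚ t + z) (sym k≡jr))
          where
          shuffle : ∀ s j t r → s + (j + t) * r ≡ s + t * r + j * r
          shuffle = solve-∀
        periodₓ : ∀ t → u (xₚ (j + t)) ≡ u (xₚ t)
        periodₓ t = trans (cong u (xₚ-period t)) (u-period (xₚ t))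
        periodᵧ : u (yₚ (j + 0)) ≡ u (yₚ 0)
        periodᵧ = trans (cong u (trans (cong (_+ s₁) (xₚ-period 0)) (shuffle (xₚ 0) k s₁))) (u-period (yₚ 0))
          where
          shuffle : ∀ x y z → x + y + z ≡ x + z + y
          shuffle = solve-∀

        contradiction : ⊥
        contradiction = noClosedWalk ℓ ℓ≡ (λ 2∣ → <⇒≱ 2<P (∣⇒≤ (∣⇒∣ᵤ 2∣))) X Y (edgeDefect (W (xₚ 0))) on on′ movesX movesY
          j 1≤j j≤ℓ (λ t → cong (λ v → coord v 0) (periodₓ t)) (λ i → cong (λ v → coord v i) periodᵧ)

      fromOffsets : (∃ λ s₀ → s₀ < suc r × colour (u s₀) ≡ a) →
        (∀ s₀ → ∃ λ s₁ → s₁ < suc r × colour (u (s₀ + s₁)) ≡ b) → suc r ∣ k → ⊥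
      fromOffsets (s₀ , _ , colour₀) offset (divides j k≡jr) with offset s₀
      ... | s₁ , s₁<r , colour₁ = contradiction s₀ s₁ j s₁<r colour₀ colour₁ k≡jr

    tcFree : TCFree (suc r) ℓ G
    tcFree m r≤m k≤ℓr contains = noTightWalk (s≤s z≤n) k≤ℓr (tightWalk χ G rainbow r≤m contains)

-- From bounded degree to a subgraph free of tight cycles

Unique-resp-⊆ : ∀ {A : Set} {xs ys : List A} → xs ⊆ ys → Unique ys → Unique xs
Unique-resp-⊆ [] [] = []
Unique-resp-⊆ (y ∷ʳ xs⊆) (_ ∷ ys!) = Unique-resp-⊆ xs⊆ ys!
Unique-resp-⊆ (refl ∷ xs⊆) (y∉ ∷ ys!) = All-resp-⊆ xs⊆ y∉ ∷ Unique-resp-⊆ xs⊆ ys!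

-- For uniformity 2 + r, the factors come from the rainbow colouring, from the choice of each of the
-- two colours, and from the separation of conflicts.
loss : ℕ → ℕ
loss r = (2 + r) ^ (2 + r) * (suc r * (suc r * 2))

module _ {ℓ′ : ℕ} (ℓ≡ : suc ℓ′ ≡ 2 ⊎ (suc ℓ′ ≡ 3 ⊎ suc ℓ′ ≡ 5)) {P : ℕ} (prime : Prime P) (2<P : 2 < P)
  (r : ℕ) {n : ℕ} (H : EdgeList (suc n)) where

  private instance
    P≢0 : NonZero P
    P≢0 = prime⇒nonZero prime
    Pˡ≢0 : NonZero (P ^ suc ℓ′)
    Pˡ≢0 = m^n≢0 P (suc ℓ′)

  tcFreeSubgraph : IsRGraph (2 + r) H → ∀ T .{{_ : NonZero T}} → maxDeg H < suc T ^ suc r → 4 * T ≤ P ^ suc ℓ′ →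
    ∃ λ G → G ⊆ H × TCFree (2 + r) (suc ℓ′) G × e H ≤ loss r * P ^ ℓ′ * e G
  tcFreeSubgraph (sizes , H!) T Δ< 4T≤ = fromRainbow (rainbowSubgraph (suc r) H sizes)
    where
    Goal = ∃ λ G → G ⊆ H × TCFree (2 + r) (suc ℓ′) G × e H ≤ loss r * P ^ ℓ′ * e G
    fromSeparated : ∀ (χ : Vec (Fin (2 + r)) (suc n)) a b → a ≢ b → (h : Vec (Fin (P ^ suc ℓ′)) (suc n)) → ∀ {G₃} → G₃ ⊆ H →
      All (Rainbow χ) G₃ →
      (∀ {e e′} → e ∈ G₃ → e′ ∈ G₃ → ∀ c → c ≡ a ⊎ c ≡ b → Coloured.AgreeOff χ (c ∷ []) e e′ → e ≢ e′ →
        lookup h (vertex χ c e) ≢ lookup h (vertex χ c e′)) →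
      e H ≤ loss r * length G₃ → Goal
    fromSeparated χ a b a≢b h {G₃} G₃⊆H R separated large =
      G , ⊆-trans G⊆G₃ G₃⊆H
        , tcFree G (All.lookup (All-resp-⊆ G⊆G₃ R)) (λ e∈ e′∈ → separated (Sub.lookup G⊆G₃ e∈) (Sub.lookup G⊆G₃ e′∈))
            (λ e∈ e′∈ → trans (proj₂ (∈-filter⁻ keyed? {xs = G₃} e∈)) (sym (proj₂ (∈-filter⁻ keyed? {xs = G₃} e′∈))))
        , (begin
          e H                          ≤⟨ large ⟩
          loss r * length G₃           ≤⟨ *-monoʳ-≤ (loss r) (proj₂ popularKey) ⟩
          loss r * (P ^ ℓ′ * length G) ≡⟨ sym (*-assoc (loss r) (P ^ ℓ′) (length G)) ⟩
          loss r * P ^ ℓ′ * e G        ∎)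
      where
      open ≤-Reasoning
      open TCFreeness ℓ′ ℓ≡ P prime 2<P χ a b a≢b h using (key; tcFree)
      popularKey = pigeonhole ℓ′ key G₃
      keyed? = λ e → Vecₚ.≡-dec Fin._≟_ (key e) (proj₁ popularKey)
      G = filter keyed? G₃
      G⊆G₃ : G ⊆ G₃
      G⊆G₃ = filter-⊆ keyed? G₃
    fromPair : ∀ (χ : Vec (Fin (2 + r)) (suc n)) a b → a ≢ b → ∀ {G₂} → G₂ ⊆ H → All (Rainbow χ) G₂ →
      (∀ {e} → e ∈ G₂ → Coloured.codegree χ a G₂ e ≤ T) → (∀ {e} → e ∈ G₂ → Coloured.codegree χ b G₂ e ≤ T) →
      e H ≤ (2 + r) ^ (2 + r) * (suc r * (suc r * length G₂)) → Goal
    fromPair χ a b a≢b {G₂} G₂⊆H R codegᵃ codegᵇ large = combine (separateEdges G₂ a b T 4T≤ R codegᵃ codegᵇ)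
      where
      open ≤-Reasoning
      regroup : ∀ x y z → x * (y * (y * (2 * z))) ≡ x * (y * (y * 2)) * z
      regroup = solve-∀
      combine : (∃ λ (h : Vec (Fin (P ^ suc ℓ′)) (suc n)) → ∃ λ G₃ → G₃ ⊆ G₂ × length G₂ ≤ 2 * length G₃ ×
        (∀ {e e′} → e ∈ G₃ → e′ ∈ G₃ → ∀ c → c ≡ a ⊎ c ≡ b → Coloured.AgreeOff χ (c ∷ []) e e′ → e ≢ e′ →
          lookup h (vertex χ c e) ≢ lookup h (vertex χ c e′))) → Goal
      combine (h , G₃ , G₃⊆ , half , separated) =
        fromSeparated χ a b a≢b h (⊆-trans G₃⊆ G₂⊆H) (All-resp-⊆ G₃⊆ R) separated (begin
          e H ≤⟨ large ⟩
          (2 + r) ^ (2 + r) * (suc r * (suc r * length G₂)) ≤⟨ *-monoʳ-≤ ((2 + r) ^ (2 + r)) (*-monoʳ-≤ (suc r) (*-monoʳ-≤ (suc r) half)) ⟩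
          (2 + r) ^ (2 + r) * (suc r * (suc r * (2 * length G₃))) ≡⟨ regroup ((2 + r) ^ (2 + r)) (suc r) (length G₃) ⟩
          loss r * length G₃ ∎)
    fromRainbow : (∃ λ (χ : Vec (Fin (2 + r)) (suc n)) → ∃ λ G₀ → G₀ ⊆ H × All (Rainbow χ) G₀ × length H ≤ (2 + r) ^ (2 + r) * length G₀) → Goal
    fromRainbow (χ , G₀ , G₀⊆ , R , large) = firstColour (thin G₀⊆ R zero)
      where
      LowCodegree : EdgeList (suc n) → Fin (2 + r) → Set
      LowCodegree K c = ∃ λ a → a ≢ c × ∃ λ G → G ⊆ K × (∀ {e} → e ∈ G → Coloured.codegree χ a G e ≤ T) × length K ≤ suc r * length G
      thin : ∀ {K} → K ⊆ H → All (Rainbow χ) K → ∀ c → LowCodegree K c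
      thin {K} K⊆H RK c = lowCodegreeColour χ {K} c T (maxDeg H) Δ<
        (λ cs c∉ {e} e∈ → countAgreeing≤maxDeg {cs = cs} {H} {K} c∉ K⊆H {e} (All.lookup RK e∈)) (Unique-resp-⊆ K⊆H H!)
      secondColour : ∀ {a G₁} → G₁ ⊆ G₀ → (∀ {e} → e ∈ G₁ → Coloured.codegree χ a G₁ e ≤ T) → length G₀ ≤ suc r * length G₁ →
        LowCodegree G₁ a → Goal
      secondColour {a} G₁⊆ codegᵃ large₁ (b , b≢a , G₂ , G₂⊆ , codegᵇ , large₂) =
        fromPair χ a b (b≢a ∘ sym) (⊆-trans G₂⊆ (⊆-trans G₁⊆ G₀⊆)) (All-resp-⊆ (⊆-trans G₂⊆ G₁⊆) R)
          (λ {e} e∈ → ≤-trans (Coloured.countAgreeing-mono χ (a ∷ []) G₂⊆ e) (codegᵃ (Sub.lookup G₂⊆ e∈))) codegᵇ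
          (≤-trans large (*-monoʳ-≤ ((2 + r) ^ (2 + r)) (≤-trans large₁ (*-monoʳ-≤ (suc r) large₂))))
      firstColour : LowCodegree G₀ zero → Goal
      -- The colour `zero` excluded in the first round is arbitrary. The second round excludes `a`,
      -- so that it finds a different colour; the bound for `a` survives in subgraphs.
      firstColour (a , _ , G₁ , G₁⊆ , codegᵃ , large₁) =
        secondColour {a} {G₁} G₁⊆ codegᵃ large₁ (thin (⊆-trans G₁⊆ G₀⊆) (All-resp-⊆ G₁⊆ R) a)

-- Choice of the prime

floorRoot : ∀ d N → ∃ λ T → T ^ suc d ≤ N × N < suc T ^ suc d
floorRoot d zero = 0 , z≤n , m^n>0 1 (suc d)
floorRoot d (suc N) with floorRoot d N
... | T , lo , hi with suc T ^ suc d ≤? suc N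
...   | yes le = suc T , le , ≤-<-trans hi (^-monoˡ-< (suc d) (n<1+n (suc T)))
...   | no ≰ = T , m≤n⇒m≤1+n lo , ≰⇒> ≰

^-distribʳ-* : ∀ m n o → (m * n) ^ o ≡ m ^ o * n ^ o
^-distribʳ-* m n zero = refl
^-distribʳ-* m n (suc o) = trans (cong (m * n *_) (^-distribʳ-* m n o)) (interchange m n (m ^ o) (n ^ o))
  where
  interchange : ∀ a b c d → a * b * (c * d) ≡ a * c * (b * d)
  interchange = solve-∀

-- The witness `z` replaces roots: up to constants, P lies between the k-th and (k + 1)-st powers of
-- z, while z ^ (kℓ) is of order T.
primeForDegree : ∀ ℓ k → 1 ≤ ℓ → 1 ≤ k → ∃ λ K → 1 ≤ K × ∀ T → 1 ≤ T → ∃ λ P → ∃ λ z →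
  Prime P × 2 < P × 4 * T ≤ P ^ ℓ × P ≤ z ^ suc k × z ^ (k * ℓ) ≤ K * T
primeForDegree ℓ@(suc ℓ-1) k@(suc k-1) _ _ = fromBound (primeBetweenPowers k)
  where
  fromBound : (∃ λ g₀ → ∀ g → g₀ ≤ g → 1 ≤ g → ∃ λ P → Prime P × (2 * g) ^ k ≤ P × P ≤ (2 * g) ^ suc k) →
    ∃ λ K → 1 ≤ K × ∀ T → 1 ≤ T → ∃ λ P → ∃ λ z → Prime P × 2 < P × 4 * T ≤ P ^ ℓ × P ≤ z ^ suc k × z ^ (k * ℓ) ≤ K * T
  fromBound (g₀ , between) = B ^ (k * ℓ) * 4 , *-mono-≤ (m^n>0 B (k * ℓ)) (s≤s z≤n) ,
    -- `floorRoot d` extracts a root of order `suc d`, and `suc (ℓ-1 + k-1 * ℓ)` is `k * ℓ`.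
    λ T 1≤T → fromRoot T 1≤T (floorRoot (ℓ-1 + k-1 * ℓ) (4 * T))
    where
    open ≤-Reasoning
    B = 2 * (2 + g₀)
    fromRoot : ∀ T → 1 ≤ T → (∃ λ t → t ^ (k * ℓ) ≤ 4 * T × 4 * T < suc t ^ (k * ℓ)) →
      ∃ λ P → ∃ λ z → Prime P × 2 < P × 4 * T ≤ P ^ ℓ × P ≤ z ^ suc k × z ^ (k * ℓ) ≤ B ^ (k * ℓ) * 4 * T
    fromRoot T 1≤T (zero , lo , hi) = ⊥-elim (<⇒≱ hi (≤-trans (≤-reflexive (^-zeroˡ (k * ℓ))) (≤-trans 1≤T (m≤m+n T _))))
    fromRoot T 1≤T (t@(suc t-1) , lo , hi) = fromPrime (between g (m≤n+m g₀ (suc t)) (s≤s z≤n))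
      where
      -- Adding `g₀` passes the threshold for primes whatever T is. It enlarges the root by at most
      -- the constant factor `B`, so no lower bound on T beyond 1 is imposed.
      g = suc t + g₀
      z = 2 * g
      fromPrime : (∃ λ P → Prime P × z ^ k ≤ P × P ≤ z ^ suc k) →
        ∃ λ P → ∃ λ z → Prime P × 2 < P × 4 * T ≤ P ^ ℓ × P ≤ z ^ suc k × z ^ (k * ℓ) ≤ B ^ (k * ℓ) * 4 * T
      fromPrime (P , P-prime , z^k≤P , P≤) = P , z , P-prime , 2<P , 4T≤ , P≤ , z^kℓ≤
        where
        2<P : 2 < P
        2<P = begin
          3 ≤⟨ n≤1+n 3 ⟩
          2 * 2 ≤⟨ *-monoʳ-≤ 2 (s≤s (s≤s z≤n)) ⟩
          z ≤⟨ m≤m*n z (z ^ k-1) {{m^n≢0 z k-1}} ⟩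
          z ^ k ≤⟨ z^k≤P ⟩
          P ∎
        4T≤ : 4 * T ≤ P ^ ℓ
        4T≤ = begin
          4 * T ≤⟨ <⇒≤ hi ⟩
          suc t ^ (k * ℓ) ≤⟨ ^-monoˡ-≤ (k * ℓ) (≤-trans (m≤m+n (suc t) g₀) (m≤m+n g (g + 0))) ⟩
          z ^ (k * ℓ) ≡⟨ sym (^-*-assoc z k ℓ) ⟩
          (z ^ k) ^ ℓ ≤⟨ ^-monoˡ-≤ ℓ z^k≤P ⟩
          P ^ ℓ ∎
        z≤tB : z ≤ t * B
        z≤tB = ≤-trans (m≤m+n z (2 * t-1 + 2 * (t-1 * g₀))) (≤-reflexive (expand t-1 g₀))
          where
          expand : ∀ s g → 2 * (2 + s + g) + (2 * s + 2 * (s * g)) ≡ (1 + s) * (2 * (2 + g))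
          expand = solve-∀
        z^kℓ≤ : z ^ (k * ℓ) ≤ B ^ (k * ℓ) * 4 * T
        z^kℓ≤ = begin
          z ^ (k * ℓ) ≤⟨ ^-monoˡ-≤ (k * ℓ) z≤tB ⟩
          (t * B) ^ (k * ℓ) ≡⟨ ^-distribʳ-* t B (k * ℓ) ⟩
          t ^ (k * ℓ) * B ^ (k * ℓ) ≤⟨ *-monoˡ-≤ (B ^ (k * ℓ)) lo ⟩
          4 * T * B ^ (k * ℓ) ≡⟨ shuffle T (B ^ (k * ℓ)) ⟩
          B ^ (k * ℓ) * 4 * T ∎
          where
          shuffle : ∀ t b → 4 * t * b ≡ b * 4 * t
          shuffle = solve-∀

-- Choosing k = ℓ′q turns the exponent of P into kℓR, which fits z ^ (kℓ) ≤ KT and T ^ R ≤ Δ. The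
-- ideal exponent of Δ would be k = ℓ′q; the gap between z ^ k and z ^ (k + 1) costs one more factor
-- Δ.
powerBound : ∀ ℓ′ R k q {P z T K Δ} → k ≡ ℓ′ * q → P ≤ z ^ suc k → z ^ (k * suc ℓ′) ≤ K * T → T ^ R ≤ Δ →
  (P ^ ℓ′) ^ (suc ℓ′ * R * q) ≤ K ^ (R * suc k) * Δ ^ suc k
powerBound ℓ′ R k q {P} {z} {T} {K} {Δ} refl P≤ z≤ T^R≤Δ = begin
  (P ^ ℓ′) ^ (suc ℓ′ * R * q) ≡⟨ ^-*-assoc P ℓ′ (suc ℓ′ * R * q) ⟩
  P ^ (ℓ′ * (suc ℓ′ * R * q)) ≤⟨ ^-monoˡ-≤ (ℓ′ * (suc ℓ′ * R * q)) P≤ ⟩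
  (z ^ suc k) ^ (ℓ′ * (suc ℓ′ * R * q)) ≡⟨ ^-*-assoc z (suc k) (ℓ′ * (suc ℓ′ * R * q)) ⟩
  z ^ (suc k * (ℓ′ * (suc ℓ′ * R * q))) ≡⟨ cong (z ^_) (regroup ℓ′ R q (suc k)) ⟩
  z ^ (k * suc ℓ′ * (R * suc k)) ≡⟨ sym (^-*-assoc z (k * suc ℓ′) (R * suc k)) ⟩
  (z ^ (k * suc ℓ′)) ^ (R * suc k) ≤⟨ ^-monoˡ-≤ (R * suc k) z≤ ⟩
  (K * T) ^ (R * suc k) ≡⟨ ^-distribʳ-* K T (R * suc k) ⟩
  K ^ (R * suc k) * T ^ (R * suc k) ≡⟨ cong (K ^ (R * suc k) *_) (sym (^-*-assoc T R (suc k))) ⟩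
  K ^ (R * suc k) * (T ^ R) ^ suc k ≤⟨ *-monoʳ-≤ (K ^ (R * suc k)) (^-monoˡ-≤ (suc k) T^R≤Δ) ⟩
  K ^ (R * suc k) * Δ ^ suc k ∎
  where
  open ≤-Reasoning
  regroup : ∀ l R q s → s * (l * ((1 + l) * R * q)) ≡ l * q * (1 + l) * (R * s)
  regroup = solve-∀

-- The exponent of the maximum degree

module _ (r ℓ′ : ℕ) (ℓ≡ : suc ℓ′ ≡ 2 ⊎ (suc ℓ′ ≡ 3 ⊎ suc ℓ′ ≡ 5)) (1≤ℓ′ : 1 ≤ ℓ′) (p q : ℕ) (0<p : 0 < p) (0<q : 0 < q) where

  private
    k N : ℕ
    k = ℓ′ * q
    N = suc ℓ′ * suc r * q

  relativeTurán : Σ ℕ λ D → (n : ℕ) (H : EdgeList n) → IsRGraph (2 + r) H → D ≤ maxDeg H →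
    Σ (EdgeList n) λ G → G ⊆ H × TCFree (2 + r) (suc ℓ′) G ×
      e H ^ N ≤ e G ^ N * maxDeg H ^ (ℓ′ * q + p * suc ℓ′ * suc r)
  relativeTurán = fromPrimes (primeForDegree (suc ℓ′) k (s≤s z≤n) (*-mono-≤ 1≤ℓ′ 0<q))
    where
    open ≤-Reasoning
    fromPrimes : (∃ λ K → 1 ≤ K × ∀ T → 1 ≤ T → ∃ λ P → ∃ λ z →
        Prime P × 2 < P × 4 * T ≤ P ^ suc ℓ′ × P ≤ z ^ suc k × z ^ (k * suc ℓ′) ≤ K * T) → _
    -- `D` gathers all constants after raising to the power `N`, so one factor of the maximum degree
    -- absorbs them. The successor makes that degree positive, which also rules out an empty vertex
    -- set.
    fromPrimes (K , 1≤K , primes) = suc D , large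
      where
      D = loss r ^ N * K ^ (suc r * suc k)
      large : (n : ℕ) (H : EdgeList n) → IsRGraph (2 + r) H → suc D ≤ maxDeg H →
        Σ (EdgeList n) λ G → G ⊆ H × TCFree (2 + r) (suc ℓ′) G ×
          e H ^ N ≤ e G ^ N * maxDeg H ^ (ℓ′ * q + p * suc ℓ′ * suc r)
      large zero H _ ()
      large (suc n) H isR D≤ = fromRoot (floorRoot r (maxDeg H))
        where
        Δ = maxDeg H
        Goal = Σ (EdgeList (suc n)) λ G → G ⊆ H × TCFree (2 + r) (suc ℓ′) G ×
          e H ^ N ≤ e G ^ N * Δ ^ (ℓ′ * q + p * suc ℓ′ * suc r)
        -- The margin pℓ(r - 1) of the theorem is at least 2: one factor Δ pays for the imprecise
        -- size of the prime, the other for the constants.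
        exponent : 2 + k ≤ ℓ′ * q + p * suc ℓ′ * suc r
        exponent = subst (_≤ k + p * suc ℓ′ * suc r) (+-comm k 2)
          (+-monoʳ-≤ k (*-mono-≤ (*-mono-≤ 0<p (s≤s 1≤ℓ′)) (s≤s {n = r} z≤n)))
        fromRoot : (∃ λ T → T ^ suc r ≤ Δ × Δ < suc T ^ suc r) → Goal
        fromRoot (zero , _ , hi) = ⊥-elim (<⇒≱ hi (≤-trans (≤-reflexive (^-zeroˡ (suc r))) (≤-trans (s≤s z≤n) D≤)))
        fromRoot (T@(suc _) , lo , hi) = fromPrime (primes T (s≤s z≤n))
          where
          fromPrime : (∃ λ P → ∃ λ z → Prime P × 2 < P × 4 * T ≤ P ^ suc ℓ′ × P ≤ z ^ suc k × z ^ (k * suc ℓ′) ≤ K * T) → Goal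
          fromPrime (P , z , P-prime , 2<P , 4T≤ , P≤ , z≤) = fromSubgraph (tcFreeSubgraph ℓ≡ P-prime 2<P r H isR T hi 4T≤)
            where
            fromSubgraph : (∃ λ G → G ⊆ H × TCFree (2 + r) (suc ℓ′) G × e H ≤ loss r * P ^ ℓ′ * e G) → Goal
            fromSubgraph (G , G⊆H , free , eH≤) = G , G⊆H , free , (begin
              e H ^ N ≤⟨ ^-monoˡ-≤ N eH≤ ⟩
              (loss r * P ^ ℓ′ * e G) ^ N ≡⟨ ^-distribʳ-* (loss r * P ^ ℓ′) (e G) N ⟩
              (loss r * P ^ ℓ′) ^ N * e G ^ N ≡⟨ *-comm _ (e G ^ N) ⟩
              e G ^ N * (loss r * P ^ ℓ′) ^ N ≤⟨ *-monoʳ-≤ (e G ^ N) bound ⟩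
              e G ^ N * Δ ^ (ℓ′ * q + p * suc ℓ′ * suc r) ∎)
              where
              bound : (loss r * P ^ ℓ′) ^ N ≤ Δ ^ (ℓ′ * q + p * suc ℓ′ * suc r)
              bound = begin
                (loss r * P ^ ℓ′) ^ N ≡⟨ ^-distribʳ-* (loss r) (P ^ ℓ′) N ⟩
                loss r ^ N * (P ^ ℓ′) ^ N ≤⟨ *-monoʳ-≤ (loss r ^ N) (powerBound ℓ′ (suc r) k q {K = K} refl P≤ z≤ lo) ⟩
                loss r ^ N * (K ^ (suc r * suc k) * Δ ^ suc k) ≡⟨ sym (*-assoc (loss r ^ N) _ (Δ ^ suc k)) ⟩
                D * Δ ^ suc k ≤⟨ *-monoˡ-≤ (Δ ^ suc k) (≤-trans (n≤1+n D) D≤) ⟩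
                Δ ^ (2 + k) ≤⟨ ^-monoʳ-≤ Δ {{>-nonZero (≤-trans (s≤s z≤n) D≤)}} exponent ⟩
                Δ ^ (ℓ′ * q + p * suc ℓ′ * suc r) ∎

-- The fraction p / q is an arbitrary positive bound for the o(1), and `D` is the degree from which
-- it holds. The inequality e(G) ≥ Δ ^ (-(ℓ - 1) / (ℓ (r - 1)) - p / q) e(H) is raised to the power
-- ℓ(r - 1)q, which clears all denominators and negative exponents.
theorem1p6 : (r ℓ : ℕ) → 2 ≤ r → (ℓ ≡ 2 ⊎ (ℓ ≡ 3 ⊎ ℓ ≡ 5)) →
    (p q : ℕ) → 0 < p → 0 < q →
    Σ ℕ λ D → (n : ℕ) (H : EdgeList n) → IsRGraph r H → D ≤ maxDeg H →
    Σ (EdgeList n) λ G → G ⊆ H × TCFree r ℓ G ×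
    e H ^ (ℓ * (r ∸ 1) * q) ≤ e G ^ (ℓ * (r ∸ 1) * q) * maxDeg H ^ ((ℓ ∸ 1) * q + p * ℓ * (r ∸ 1))
theorem1p6 (suc (suc r)) ℓ _ (inj₁ refl) = relativeTurán r 1 (inj₁ refl) (s≤s z≤n)
theorem1p6 (suc (suc r)) ℓ _ (inj₂ (inj₁ refl)) = relativeTurán r 2 (inj₂ (inj₁ refl)) (s≤s z≤n)
theorem1p6 (suc (suc r)) ℓ _ (inj₂ (inj₂ refl)) = relativeTurán r 4 (inj₂ (inj₂ refl)) (s≤s z≤n)
theorem1p6 (suc zero) ℓ (s≤s ())
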